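{- Let $\mathcal B$ be a finite set of bad events over independent variables drawn from a product distribution $\Omega$, and let $\mu:\mathcal B\to[0,\infty)$ satisfy $\mu(B)\ge\theta(B)$ for all $B\in\mathcal B$. Let $E$ be any event, and let $B\in\mathcal B$. Then, for the execution of the MT algorithm, $$\sum_{t=1}^{T}P\bigl(E(X^t)\wedge B^t=B\bigr)\ \le\ \mu(B)\,\theta(E),$$ where the left-hand side means the expected number of times $t\in\{1,\dots,T\}$ such that $E$ is true in the configuration $X^t$ and $B^t=B$.
   Context: Setting. The variables $X_1,\dots,X_n$ are independent and integer-valued, with joint product distribution $\Omega$. An event is a Boolean function of a subset of the variables (the variables it involves). Write $E\sim E'$ if they involve a common variable (in particular $E\sim E$). $N(E)=\{B\in\mathcal B:B\sim E\}$ is the inclusive neighborhood. A set of bad events is independent if no two distinct members are related by $\sim$. For any event $E$ (in $\mathcal B$ or not), $$\theta(E)=P_\Omega(E)\sum_{\substack{I\subseteq N(E)\\ I\text{ independent}}}\ \prod_{B\in I}\mu(B).$$ Moser-Tardos (MT) algorithm: draw $X_1,\dots,X_n$ from $\Omega$; while some bad event is true, choose a currently-true bad event $B$ by some fixed (possibly randomized) rule and resample $B$, i.e. redraw independently from $\Omega$ all variables involved in $B$. $T$ is the termination time (number of resamplings; $\infty$ if the algorithm runs forever), $X^t$ is the configuration of the variables after $t$ resamplings ($X^0$ is the initial configuration), and $B^t$ is the bad event resampled at time $t$, for $t=1,\dots,T$. $P$ refers to the randomness of the execution of the algorithm, $P_\Omega$ to the distribution $\Omega$. -}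

module Defs where

open import Data.Bool using (Bool; T; if_then_else_)
open import Data.Fin using (Fin)
open import Data.Fin.Subset using (Subset; _∈_; _∩_; Nonempty)
open import Data.Integer using (ℤ)
open import Data.List using (List; []; foldr; map)
open import Data.List.Relation.Unary.AllPairs using ([])
open import Data.List.Relation.Unary.Unique.Propositional using (Unique)
open import Data.Nat using (ℕ; zero; suc)
open import Data.Product using (∃-syntax; _×_; _,_)
open import Data.Rational using (ℚ; 0ℚ; 1ℚ; -_; positive; nonNegative)
import Data.Rational as ℚ
import Data.Rational.Properties as ℚ
open import Data.Sum using (_⊎_; inj₁; inj₂)
open import Data.Vec using (Vec; lookup)
import Data.Vec.Functional as Vector
open import Relation.Binary.PropositionalEquality using (_≡_; _≢_; sym; trans; cong; subst)
open import Relation.Nullary using (¬_)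

infix  4 _≤_ _≈_ _⊨_ _∼_ _≈ᵉ_
infixl 6 _+_
infixl 7 _*_

-- Extended non-negative reals.
--
-- A number x ∈ [0,∞] is represented by its open lower cut { q ∈ ℚ | q < x }.
-- Every quantity here is non-negative, and in [0,∞] sums of arbitrary
-- families exist as suprema, so no convergence side conditions are needed.
-- (Classically these cuts are exactly the points of [0,∞]; constructively
-- they include all non-negative Dedekind reals.)

record ℝ≥0∞ : Set₁ where
  field
    Below    : ℚ → Set
    negative : ∀ {q} → q ℚ.< 0ℚ → Below q
    downward : ∀ {p q} → p ℚ.≤ q → Below q → Below p
    rounded  : ∀ {q} → Below q → ∃[ r ] (q ℚ.< r × Below r)

open ℝ≥0∞ public

_≤_ : ℝ≥0∞ → ℝ≥0∞ → Set
x ≤ y = ∀ q → Below x q → Below y q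

_≈_ : ℝ≥0∞ → ℝ≥0∞ → Set
x ≈ y = x ≤ y × y ≤ x

-- x < ∞.
Finite : ℝ≥0∞ → Set
Finite x = ∃[ q ] ¬ Below x q

0# : ℝ≥0∞
0# = record
  { Below    = ℚ._< 0ℚ
  ; negative = λ q<0 → q<0
  ; downward = ℚ.≤-<-trans
  ; rounded  = λ q<0 → let r , q<r , r<0 = ℚ.<-dense q<0 in r , q<r , r<0
  }

0<1 : 0ℚ ℚ.< 1ℚ
0<1 = ℚ.positive⁻¹ 1ℚ

1# : ℝ≥0∞
1# = record
  { Below    = ℚ._< 1ℚ
  ; negative = λ q<0 → ℚ.<-trans q<0 0<1
  ; downward = ℚ.≤-<-trans
  ; rounded  = λ q<1 → let r , q<r , r<1 = ℚ.<-dense q<1 in r , q<r , r<1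
  }

-- The indicator: 1 if P holds, 0 otherwise.
𝟙 : Set → ℝ≥0∞
𝟙 P = record
  { Below    = λ q → q ℚ.< 0ℚ ⊎ (P × q ℚ.< 1ℚ)
  ; negative = inj₁
  ; downward = λ { p≤q (inj₁ q<0)       → inj₁ (ℚ.≤-<-trans p≤q q<0)
                 ; p≤q (inj₂ (h , q<1)) → inj₂ (h , ℚ.≤-<-trans p≤q q<1) }
  ; rounded  = λ { (inj₁ q<0) →
                     let r , q<r , r<0 = ℚ.<-dense q<0 in r , q<r , inj₁ r<0
                 ; (inj₂ (h , q<1)) →
                     let r , q<r , r<1 = ℚ.<-dense q<1 in r , q<r , inj₂ (h , r<1) }
  }

split-negative : ∀ {q} → q ℚ.< 0ℚ →
                 ∃[ a ] ∃[ b ] (a ℚ.< 0ℚ × b ℚ.< 0ℚ × q ℚ.≤ a ℚ.+ b)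
split-negative {q} q<0 =
  let a , q<a , a<0 = ℚ.<-dense q<0
      q-a<0 = subst (q ℚ.- a ℚ.<_) (ℚ.+-inverseʳ a) (ℚ.+-monoˡ-< (- a) q<a)
      a+[q-a]≡q = trans (ℚ.+-comm a (q ℚ.- a))
                 (trans (ℚ.+-assoc q (- a) a)
                 (trans (cong (q ℚ.+_) (ℚ.+-inverseˡ a)) (ℚ.+-identityʳ q)))
  in a , q ℚ.- a , a<0 , q-a<0 , ℚ.≤-reflexive (sym a+[q-a]≡q)

_+_ : ℝ≥0∞ → ℝ≥0∞ → ℝ≥0∞
x + y = record
  { Below    = λ q → ∃[ a ] ∃[ b ] (Below x a × Below y b × q ℚ.≤ a ℚ.+ b)
  ; negative = λ q<0 →
      let a , b , a<0 , b<0 , q≤a+b = split-negative q<0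
      in a , b , negative x a<0 , negative y b<0 , q≤a+b
  ; downward = λ { p≤q (a , b , a<x , b<y , q≤a+b) →
                     a , b , a<x , b<y , ℚ.≤-trans p≤q q≤a+b }
  ; rounded  = λ { (a , b , a<x , b<y , q≤a+b) →
      let a′ , a<a′ , a′<x = rounded x a<x
          b′ , b<b′ , b′<y = rounded y b<y
      in a′ ℚ.+ b′ , ℚ.≤-<-trans q≤a+b (ℚ.+-mono-< a<a′ b<b′)
       , a′ , b′ , a′<x , b′<y , ℚ.≤-refl }
  }

*-mono-<-nonNeg : ∀ {a a′ b b′} → 0ℚ ℚ.≤ a → 0ℚ ℚ.≤ b → a ℚ.< a′ → b ℚ.< b′ →
                  a ℚ.* b ℚ.< a′ ℚ.* b′
*-mono-<-nonNeg {a} {a′} {b} {b′} 0≤a 0≤b a<a′ b<b′ = ℚ.≤-<-trans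
  (ℚ.*-monoˡ-≤-nonNeg a {{nonNegative 0≤a}} (ℚ.<⇒≤ b<b′))
  (ℚ.*-monoˡ-<-pos b′ {{positive (ℚ.≤-<-trans 0≤b b<b′)}} a<a′)

-- In particular 0 · ∞ = 0, since no a ≥ 0 lies strictly below 0.
_*_ : ℝ≥0∞ → ℝ≥0∞ → ℝ≥0∞
x * y = record
  { Below    = λ q → q ℚ.< 0ℚ ⊎
                 ∃[ a ] ∃[ b ] (0ℚ ℚ.≤ a × 0ℚ ℚ.≤ b × Below x a × Below y b × q ℚ.≤ a ℚ.* b)
  ; negative = inj₁
  ; downward = λ
      { p≤q (inj₁ q<0) → inj₁ (ℚ.≤-<-trans p≤q q<0)
      ; p≤q (inj₂ (a , b , 0≤a , 0≤b , a<x , b<y , q≤ab)) →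
          inj₂ (a , b , 0≤a , 0≤b , a<x , b<y , ℚ.≤-trans p≤q q≤ab) }
  ; rounded  = λ
      { (inj₁ q<0) → let r , q<r , r<0 = ℚ.<-dense q<0 in r , q<r , inj₁ r<0
      ; (inj₂ (a , b , 0≤a , 0≤b , a<x , b<y , q≤ab)) →
          let a′ , a<a′ , a′<x = rounded x a<x
              b′ , b<b′ , b′<y = rounded y b<y
          in a′ ℚ.* b′ , ℚ.≤-<-trans q≤ab (*-mono-<-nonNeg 0≤a 0≤b a<a′ b<b′)
           , inj₂ (a′ , b′ , ℚ.≤-trans 0≤a (ℚ.<⇒≤ a<a′) , ℚ.≤-trans 0≤b (ℚ.<⇒≤ b<b′)
                  , a′<x , b′<y , ℚ.≤-refl) }
  }

sumOver : {A : Set} → (A → ℝ≥0∞) → List A → ℝ≥0∞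
sumOver f xs = foldr _+_ 0# (map f xs)

-- The unordered sum of f over the whole type A: the supremum of the sums over
-- finite subsets of A, a finite subset being listed without repetition.
∑ : {A : Set} → (A → ℝ≥0∞) → ℝ≥0∞
∑ {A} f = record
  { Below    = λ q → ∃[ xs ] (Unique xs × Below (sumOver f xs) q)
  ; negative = λ q<0 → [] , [] , q<0
  ; downward = λ { p≤q (xs , u , q<s) → xs , u , downward (sumOver f xs) p≤q q<s }
  ; rounded  = λ { (xs , u , q<s) →
      let r , q<r , r<s = rounded (sumOver f xs) q<s in r , q<r , xs , u , r<s }
  }

∏ : ∀ {k} → (Fin k → ℝ≥0∞) → ℝ≥0∞
∏ = Vector.foldr _*_ 1#

record Distribution (A : Set) : Set₁ where
  field
    mass  : A → ℝ≥0∞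
    total : ∑ mass ≈ 1#

open Distribution public

Config : ℕ → Set
Config n = Vec ℤ n

-- A product distribution of n independent integer-valued variables, given by
-- its marginals.
ProductDistribution : ℕ → Set₁
ProductDistribution n = Fin n → Distribution ℤ

pmf : ∀ {n} → ProductDistribution n → Config n → ℝ≥0∞
pmf Ω x = ∏ λ i → mass (Ω i) (lookup x i)

record Event (n : ℕ) : Set where
  field
    vars  : Subset n
    holds : Config n → Bool
    local : ∀ x y → (∀ i → i ∈ vars → lookup x i ≡ lookup y i) → holds x ≡ holds y

open Event public

_⊨_ : ∀ {n} → Config n → Event n → Set
x ⊨ E = T (holds E x)

-- Extensional equality: the same Boolean function of the same variables.
_≈ᵉ_ : ∀ {n} → Event n → Event n → Set
E ≈ᵉ F = vars E ≡ vars F × (∀ x → holds E x ≡ holds F x)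

-- The first alternative only matters for events involving no variable at all;
-- it makes E ∼ E hold for every E.
_∼_ : ∀ {n} → Event n → Event n → Set
E ∼ F = E ≈ᵉ F ⊎ Nonempty (vars E ∩ vars F)

PΩ : ∀ {n} → ProductDistribution n → Event n → ℝ≥0∞
PΩ Ω E = ∑ λ x → pmf Ω x * 𝟙 (x ⊨ E)

-- A finite set of m bad events, listed without repetition.
record BadEvents (n m : ℕ) : Set where
  field
    event    : Fin m → Event n
    distinct : ∀ b c → event b ≈ᵉ event c → b ≡ c

open BadEvents public

module _ {n m : ℕ} (𝓑 : BadEvents n m) where

  -- I ⊆ N(E)
  _⊆N_ : Subset m → Event n → Set
  I ⊆N E = ∀ b → b ∈ I → event 𝓑 b ∼ E

  Independent : Subset m → Set
  Independent I = ∀ b c → b ∈ I → c ∈ I → b ≢ c → ¬ (event 𝓑 b ∼ event 𝓑 c)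

  θ : ProductDistribution n → (Fin m → ℝ≥0∞) → Event n → ℝ≥0∞
  θ Ω μ E = PΩ Ω E *
    ∑ λ (I : Subset m) →
      𝟙 (I ⊆N E × Independent I) * ∏ λ b → if lookup I b then μ b else 1#

-- Run n m t: a possible record of an execution up to and including its t-th
-- resampling, i.e. X⁰, B¹, X¹, …, Bᵗ, Xᵗ.
data Run (n m : ℕ) : ℕ → Set where
  start  : Config n → Run n m zero
  extend : ∀ {t} → Run n m t → Fin m → Config n → Run n m (suc t)

-- Xᵗ
current : ∀ {n m t} → Run n m t → Config n
current (start x)      = x
current (extend _ _ x) = x

-- Bᵗ, for t ≥ 1
resampled : ∀ {n m t} → Run n m (suc t) → Fin m
resampled (extend _ b _) = b

-- A randomized selection rule: choice r b is the conditional probability,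
-- given the history r, that b is the next event to be resampled.  If no bad
-- event is true, choice r is identically 0: the algorithm has terminated.
record Rule {n m : ℕ} (𝓑 : BadEvents n m) : Set₁ where
  field
    choice     : ∀ {t} → Run n m t → Fin m → ℝ≥0∞
    only-true  : ∀ {t} (r : Run n m t) b → ¬ (current r ⊨ event 𝓑 b) → choice r b ≈ 0#
    normalized : ∀ {t} (r : Run n m t) → (∃[ b ] (current r ⊨ event 𝓑 b)) →
                 ∑ (choice r) ≈ 1#

open Rule public

-- The probability that resampling E in configuration x results in y.
resample : ∀ {n} → ProductDistribution n → Event n → Config n → Config n → ℝ≥0∞
resample Ω E x y = ∏ λ i →
  if lookup (vars E) i then mass (Ω i) (lookup y i) else 𝟙 (lookup y i ≡ lookup x i)

module MoserTardos {n m : ℕ} (Ω : ProductDistribution n) (𝓑 : BadEvents n m) (σ : Rule 𝓑) where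

  -- The probability that T ≥ t and that the execution begins with r.
  runProb : ∀ {t} → Run n m t → ℝ≥0∞
  runProb (start x)      = pmf Ω x
  runProb (extend r b y) = runProb r * choice σ r b * resample Ω (event 𝓑 b) (current r) y

  -- The probability that T ≥ t and that the first t steps satisfy A.
  P : ∀ {t} → (Run n m t → Set) → ℝ≥0∞
  P A = ∑ λ r → runProb r * 𝟙 (A r)

  -- The sum over t = 1, …, T of P (E(Xᵗ) ∧ Bᵗ = b).  Since P already includes
  -- the condition t ≤ T, the sum is over all t ≥ 1.
  expectedCount : Event n → Fin m → ℝ≥0∞
  expectedCount E b =
    ∑ λ (t : ℕ) → P {suc t} λ r → current r ⊨ E × resampled r ≡ b

{-# OPTIONS --safe #-}
module Submission where

-- For a bad event c let fire c be the operator f ↦ (x ↦ 1[x ⊨ c] · 𝔼 f(x with the variables of c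
-- redrawn)).  Operators of unrelated events commute, and 𝔼 (fire c f) = P_Ω(c) · 𝔼 f.  A history of
-- resamplings that matters for "b is resampled and then E holds" is recorded by a sequence of
-- independent sets I₁ ⊆ N(b) ∪ N(E), I₂ ⊆ N(I₁), …, where each event sits in the first set in which
-- it can be placed when the history is read backwards.  The potential Φ_d is the sum of
-- fire I_d ⋯ fire I₁ (fire b 1_E) over all such sequences.  Prefixing a resampling of c to a
-- sequence either yields another sequence, injectively, or c is unrelated to everything in it and
-- fire c can be moved through and dropped; hence fire c (1[c = b] 1_E + Φ_d) ≤ Φ_{d+1}, and the
-- expected count over d steps is at most 𝔼 Φ_d, whatever the selection rule.  With
-- M(K) = ∑ ∏ μ over the independent I ⊆ K, submultiplicativity M(K ∪ K′) ≤ M(K) M(K′) and θ ≤ μ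
-- give 𝔼 Φ_d ≤ M(N(b) ∪ N(E)) P_Ω(b) P_Ω(E) ≤ θ(b) θ(E) ≤ μ(b) θ(E).

open import Algebra.Bundles using (CommutativeSemiring)
import Algebra.Properties.CommutativeSemigroup as CommutativeSemigroupProperties
open import Algebra.Structures using (IsCommutativeSemiring)
open import Algebra.Structures.Biased using (isCommutativeSemiringˡ)
open import Data.Bool using (true; false; T; if_then_else_; _∧_; not)
open import Data.Bool.Properties as Bool using (T?)
open import Data.Empty using (⊥)
open import Data.Fin using (Fin; zero; suc)
import Data.Fin.Properties as Fin
open import Data.Fin.Subset as Subset using (Subset; inside; outside; ⊤; _∈_; _∉_; _∩_; _∪_; ∁)
open import Data.Fin.Subset.Properties
  using (_∈?_; ∉⊥; Empty-unique; nonempty?; x∈p∩q⁺; x∈p∩q⁻; x∈∁p⇒x∉p; ∩-comm; ∩-identityʳ;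
         ∩-distribˡ-∪; ∪-inverseʳ)
open import Data.Integer as ℤ using (ℤ; 0ℤ)
open import Data.List as List using (List; []; _∷_; _++_; foldr; map; cartesianProduct; deduplicate)
import Data.List.Membership.Propositional as List
open import Data.List.Membership.Propositional.Properties
  using (∈-∃++; ∈-++⁺ˡ; ∈-++⁺ʳ; ∈-++⁻; ∈-map⁺; ∈-cartesianProduct⁺; ∈-deduplicate⁺)
open import Data.List.Relation.Binary.Subset.Propositional using (_⊆_)
open import Data.List.Relation.Unary.All as All using (All; []; _∷_)
open import Data.List.Relation.Unary.AllPairs using ([]; _∷_)
open import Data.List.Relation.Unary.Any using (here; there)
open import Data.List.Relation.Unary.Unique.DecPropositional.Properties using (deduplicate-!)
open import Data.List.Relation.Unary.Unique.Propositional using (Unique)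
open import Data.List.Relation.Unary.Unique.Propositional.Properties using (cartesianProduct⁺)
open import Data.Nat as ℕ using (ℕ)
open import Data.Nat.ListAction using (sum)
import Data.Nat.Properties as ℕ
open import Data.Product using (Σ-syntax; ∃-syntax; _×_; _,_; proj₁; proj₂)
import Data.Product.Properties as Product
open import Data.Rational using (0ℚ; 1ℚ; 1/_; positive; nonNegative)
import Data.Rational as ℚ
import Data.Rational.Properties as ℚ
open import Data.Sum using (_⊎_; inj₁; inj₂)
open import Data.Vec as Vec using ([]; _∷_; lookup; here; there; _[_]≔_; replicate; tabulate)
import Data.Vec.Functional as Vector
import Data.Vec.Properties as Vec
open import Function using (_∘_)
import Level
open import Relation.Binary.Bundles using (Poset)
open import Relation.Binary.Definitions using (DecidableEquality)
open import Relation.Binary.PropositionalEquality as ≡ using (_≡_; _≢_)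
import Relation.Binary.Reasoning.PartialOrder as PartialOrderReasoning
open import Relation.Binary.Structures using (IsEquivalence; IsPartialOrder)
open import Relation.Nullary using (¬_; Dec; yes; no; does; contradiction)
open import Relation.Nullary.Decidable using (_×-dec_; _⊎-dec_; ¬?; map′)
import Relation.Unary as Unary
open import Defs using (Config; Event; vars; holds; local; _⊨_; _∼_; BadEvents; event; Independent;
  Run; start; extend; current; resampled)

-- Ordered semirings with unordered sums

-- The properties of [0,∞] on which the probabilistic argument rests. Working over an abstract
-- structure keeps the rational cuts from unfolding inside it.
record SummableSemiring : Set₂ where
  infix 4 _≤_
  field
    commutativeSemiring : CommutativeSemiring (Level.suc Level.zero) Level.zero

  open CommutativeSemiring commutativeSemiring public hiding (zero)

  sumOver : {A : Set} → (A → Carrier) → List A → Carrier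
  sumOver f xs = foldr _+_ 0# (map f xs)

  field
    _≤_ : Carrier → Carrier → Set
    ≤-isPartialOrder : IsPartialOrder _≈_ _≤_
    0≤_ : ∀ x → 0# ≤ x
    +-mono : ∀ {x y u v} → x ≤ y → u ≤ v → x + u ≤ y + v
    *-mono : ∀ {x y u v} → x ≤ y → u ≤ v → x * u ≤ y * v
    𝟙 : Set → Carrier
    𝟙-true : ∀ {P} → P → 1# ≤ 𝟙 P
    𝟙-elim : ∀ {P x y} → (P → x ≤ y) → 𝟙 P * x ≤ y
    ∑ : {A : Set} → (A → Carrier) → Carrier
    sumOver≤∑ : ∀ {A} {f : A → Carrier} {xs} → Unique xs → sumOver f xs ≤ ∑ f
    -- `∑ f` is a supremum that shifts and factors preserve. With no subtraction or division at
    -- hand, both forms are stated with the extra summand or factor in place.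
    +-∑-least : ∀ {A x y} {f : A → Carrier} →
                (∀ xs → Unique xs → x + sumOver f xs ≤ y) → x + ∑ f ≤ y
    *-∑-least : ∀ {A x y} {f : A → Carrier} →
                (∀ xs → Unique xs → x * sumOver f xs ≤ y) → x * ∑ f ≤ y

module Summation (R : SummableSemiring) where
  open SummableSemiring R public
  open IsPartialOrder ≤-isPartialOrder public
    using ()
    renaming (refl to ≤-refl; trans to ≤-trans; antisym to ≤-antisym; reflexive to ≤-reflexive)

  poset : Poset _ _ _
  poset = record { isPartialOrder = ≤-isPartialOrder }

  open PartialOrderReasoning poset public hiding (start)
  module +-Shuffle = CommutativeSemigroupProperties +-commutativeSemigroup
  module *-Shuffle = CommutativeSemigroupProperties *-commutativeSemigroup

  ≥-reflexive : ∀ {x y} → x ≈ y → y ≤ x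
  ≥-reflexive = ≤-reflexive ∘ sym

  *-monoʳ : ∀ {x u v} → u ≤ v → x * u ≤ x * v
  *-monoʳ = *-mono ≤-refl

  x≤x+y : ∀ {x y} → x ≤ x + y
  x≤x+y {x} {y} = ≤-trans (≥-reflexive (+-identityʳ x)) (+-mono ≤-refl (0≤ y))

  y≤x+y : ∀ {x y} → y ≤ x + y
  y≤x+y {x} {y} = ≤-trans x≤x+y (≤-reflexive (+-comm y x))

  𝟙-intro : ∀ {P x} → P → x ≤ 𝟙 P * x
  𝟙-intro {x = x} p = ≤-trans (≥-reflexive (*-identityˡ x)) (*-mono (𝟙-true p) ≤-refl)

  𝟙-false : ∀ {P x y} → ¬ P → 𝟙 P * x ≤ y
  𝟙-false ¬p = 𝟙-elim λ p → contradiction p ¬p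

  𝟙≤1 : ∀ {P} → 𝟙 P ≤ 1#
  𝟙≤1 {P} = ≤-trans (≥-reflexive (*-identityʳ (𝟙 P))) (𝟙-elim λ _ → ≤-refl)

  𝟙-least : ∀ {P x} → (P → 1# ≤ x) → 𝟙 P ≤ x
  𝟙-least {P} h = ≤-trans (≥-reflexive (*-identityʳ (𝟙 P))) (𝟙-elim h)

  𝟙-map : ∀ {P x y} → (P → x ≤ y) → 𝟙 P * x ≤ 𝟙 P * y
  𝟙-map h = 𝟙-elim λ p → ≤-trans (h p) (𝟙-intro p)

  𝟙-× : ∀ {P Q x} → 𝟙 (P × Q) * x ≤ 𝟙 P * (𝟙 Q * x)
  𝟙-× = 𝟙-elim λ (p , q) → ≤-trans (𝟙-intro q) (𝟙-intro p)

  𝟙-split : ∀ {P Q x} → Dec Q → 𝟙 (P × Q) * x + 𝟙 (P × ¬ Q) * x ≈ 𝟙 P * x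
  𝟙-split {P} {Q} {x} (yes q) = ≤-antisym
    (≤-trans (+-mono (𝟙-elim λ (p , _) → 𝟙-intro p) (𝟙-false λ (_ , ¬q) → ¬q q))
             (≤-reflexive (+-identityʳ _)))
    (≤-trans (𝟙-elim λ p → 𝟙-intro (p , q)) x≤x+y)
  𝟙-split {P} {Q} {x} (no ¬q) = ≤-antisym
    (≤-trans (+-mono (𝟙-false λ (_ , q) → ¬q q) (𝟙-elim λ (p , _) → 𝟙-intro p))
             (≤-reflexive (+-identityˡ _)))
    (≤-trans (𝟙-elim λ p → 𝟙-intro (p , ¬q)) y≤x+y)

  -- Finite sums over lists

  module _ {A : Set} where

    sumOver-mono : {f g : A → Carrier} → (∀ a → f a ≤ g a) → ∀ xs → sumOver f xs ≤ sumOver g xs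
    sumOver-mono f≤g []       = ≤-refl
    sumOver-mono f≤g (x ∷ xs) = +-mono (f≤g x) (sumOver-mono f≤g xs)

    sumOver-+ : (f g : A → Carrier) → ∀ xs →
                sumOver (λ a → f a + g a) xs ≈ sumOver f xs + sumOver g xs
    sumOver-+ f g []       = sym (+-identityʳ 0#)
    sumOver-+ f g (x ∷ xs) =
      trans (+-congˡ (sumOver-+ f g xs)) (+-Shuffle.interchange _ _ _ _)

    sumOver-* : ∀ k (f : A → Carrier) xs → sumOver (λ a → k * f a) xs ≈ k * sumOver f xs
    sumOver-* k f []       = sym (zeroʳ k)
    sumOver-* k f (x ∷ xs) = trans (+-congˡ (sumOver-* k f xs)) (sym (distribˡ k _ _))

    sumOver-++ : (f : A → Carrier) → ∀ xs ys → sumOver f (xs ++ ys) ≈ sumOver f xs + sumOver f ys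
    sumOver-++ f []       ys = sym (+-identityˡ _)
    sumOver-++ f (x ∷ xs) ys = trans (+-congˡ (sumOver-++ f xs ys)) (sym (+-assoc _ _ _))

    sumOver-∷-middle : (f : A → Carrier) → ∀ y xs ys →
                       sumOver f (xs ++ y ∷ ys) ≈ f y + sumOver f (xs ++ ys)
    sumOver-∷-middle f y []       ys = refl
    sumOver-∷-middle f y (x ∷ xs) ys =
      trans (+-congˡ (sumOver-∷-middle f y xs ys)) (+-Shuffle.x∙yz≈y∙xz _ _ _)

    -- Each head of `xs` is removed from `ys` at one occurrence; since `xs` has no repetition, its
    -- tail is still contained in what remains.
    sumOver-⊆ : (f : A → Carrier) → ∀ {xs ys} → Unique xs → xs ⊆ ys → sumOver f xs ≤ sumOver f ys
    sumOver-⊆ f {[]}     {ys} _ _ = 0≤ _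
    sumOver-⊆ f {x ∷ xs} (x∉xs ∷ xs!) xxs⊆ys with ∈-∃++ (xxs⊆ys (here ≡.refl))
    ... | ys₁ , ys₂ , ≡.refl = begin
      f x + sumOver f xs           ≤⟨ +-mono ≤-refl (sumOver-⊆ f xs! xs⊆) ⟩
      f x + sumOver f (ys₁ ++ ys₂) ≈⟨ sumOver-∷-middle f x ys₁ ys₂ ⟨
      sumOver f (ys₁ ++ x ∷ ys₂)   ∎
      where
      xs⊆ : xs ⊆ ys₁ ++ ys₂
      xs⊆ z∈xs with ∈-++⁻ ys₁ (xxs⊆ys (there z∈xs))
      ... | inj₁ z∈ys₁            = ∈-++⁺ˡ z∈ys₁
      ... | inj₂ (here ≡.refl)    = contradiction ≡.refl (All.lookup x∉xs z∈xs)
      ... | inj₂ (there z∈ys₂)    = ∈-++⁺ʳ ys₁ z∈ys₂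

    sumOver-map : {B : Set} (g : A → B) (f : B → Carrier) → ∀ xs →
                  sumOver f (map g xs) ≈ sumOver (f ∘ g) xs
    sumOver-map g f []       = refl
    sumOver-map g f (x ∷ xs) = +-congˡ (sumOver-map g f xs)

  sumOver-zero : {A : Set} (xs : List A) → sumOver (λ _ → 0#) xs ≈ 0#
  sumOver-zero []       = refl
  sumOver-zero (x ∷ xs) = trans (+-identityˡ _) (sumOver-zero xs)

  module _ {A B : Set} where

    sumOver-swap : (f : A → B → Carrier) → ∀ xs ys →
      sumOver (λ a → sumOver (f a) ys) xs ≈ sumOver (λ b → sumOver (λ a → f a b) xs) ys
    sumOver-swap f []       ys = sym (sumOver-zero ys)
    sumOver-swap f (x ∷ xs) ys =
      trans (+-congˡ (sumOver-swap f xs ys)) (sym (sumOver-+ (f x) _ ys))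

    sumOver-cartesianProduct : (f : A × B → Carrier) → ∀ xs ys →
      sumOver f (cartesianProduct xs ys) ≈ sumOver (λ a → sumOver (λ b → f (a , b)) ys) xs
    sumOver-cartesianProduct f []       ys = refl
    sumOver-cartesianProduct f (x ∷ xs) ys = trans (sumOver-++ f (map (x ,_) ys) _)
      (+-cong (sumOver-map (x ,_) f ys) (sumOver-cartesianProduct f xs ys))

  -- Unordered sums: comparison, reindexing and interchange

  ∑-least : ∀ {A} {f : A → Carrier} {y} → (∀ xs → Unique xs → sumOver f xs ≤ y) → ∑ f ≤ y
  ∑-least h = ≤-trans (≥-reflexive (+-identityˡ _))
    (+-∑-least λ xs xs! → ≤-trans (≤-reflexive (+-identityˡ _)) (h xs xs!))

  ∑-mono : ∀ {A} {f g : A → Carrier} → (∀ a → f a ≤ g a) → ∑ f ≤ ∑ g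
  ∑-mono f≤g = ∑-least λ xs xs! → ≤-trans (sumOver-mono f≤g xs) (sumOver≤∑ xs!)

  ∑-cong : ∀ {A} {f g : A → Carrier} → (∀ a → f a ≈ g a) → ∑ f ≈ ∑ g
  ∑-cong f≈g = ≤-antisym (∑-mono (≤-reflexive ∘ f≈g)) (∑-mono (≥-reflexive ∘ f≈g))

  ∑-point : ∀ {A} (f : A → Carrier) a → f a ≤ ∑ f
  ∑-point f a = ≤-trans (≥-reflexive (+-identityʳ (f a))) (sumOver≤∑ ([] ∷ []))

  *-distribˡ-∑ : ∀ {A} k (f : A → Carrier) → k * ∑ f ≈ ∑ λ a → k * f a
  *-distribˡ-∑ k f = ≤-antisym
    (*-∑-least λ xs xs! → ≤-trans (≥-reflexive (sumOver-* k f xs)) (sumOver≤∑ xs!))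
    (∑-least λ xs xs! → ≤-trans (≤-reflexive (sumOver-* k f xs)) (*-mono ≤-refl (sumOver≤∑ xs!)))

  *-distribʳ-∑ : ∀ {A} k (f : A → Carrier) → ∑ f * k ≈ ∑ λ a → f a * k
  *-distribʳ-∑ k f =
    trans (*-comm _ k) (trans (*-distribˡ-∑ k f) (∑-cong λ a → *-comm k (f a)))

  ∑-+-≤ : ∀ {A} (f g : A → Carrier) → ∑ (λ a → f a + g a) ≤ ∑ f + ∑ g
  ∑-+-≤ f g = ∑-least λ xs xs! → ≤-trans (≤-reflexive (sumOver-+ f g xs))
    (+-mono (sumOver≤∑ xs!) (sumOver≤∑ xs!))

  module _ {A B : Set} {P : A → Set} (P? : Unary.Decidable P) (g : A → B)
           (g-injective : ∀ {a a′} → P a → P a′ → g a ≡ g a′ → a ≡ a′)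
           {f : A → Carrier} {h : B → Carrier}
           (f≤0 : ∀ a → ¬ P a → f a ≤ 0#) (f≤h : ∀ a → P a → f a ≤ h (g a)) where

    private
      -- Terms outside `P` are at most zero and are discarded. The preimages kept in the last
      -- component make the image list free of repetition: a second `g x` would force `x` into the
      -- tail, by injectivity on `P`.
      image : ∀ xs → Unique xs → ∃[ ys ] Unique ys × sumOver f xs ≤ sumOver h ys ×
              All (λ y → ∃[ x ] x List.∈ xs × P x × y ≡ g x) ys
      image []       []          = [] , [] , ≤-refl , []
      image (x ∷ xs) (x∉xs ∷ xs!) with image xs xs! | P? x
      ... | ys , ys! , s≤ , from | yes px =
        g x ∷ ys
        , All.map (λ { (z , z∈xs , pz , ≡.refl) eq →
            All.lookup x∉xs z∈xs (g-injective px pz eq) }) from ∷ ys!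
        , +-mono (f≤h x px) s≤
        , (x , here ≡.refl , px , ≡.refl)
          ∷ All.map (λ (z , z∈xs , rest) → z , there z∈xs , rest) from
      ... | ys , ys! , s≤ , from | no ¬px =
        ys , ys!
        , ≤-trans (+-mono (f≤0 x ¬px) s≤) (≤-reflexive (+-identityˡ _))
        , All.map (λ (z , z∈xs , rest) → z , there z∈xs , rest) from

    ∑-reindex : ∑ f ≤ ∑ h
    ∑-reindex = ∑-least λ xs xs! → let ys , ys! , s≤ , _ = image xs xs! in
      ≤-trans s≤ (sumOver≤∑ ys!)

  ∑-injection : ∀ {A B} (g : A → B) → (∀ {a a′} → g a ≡ g a′ → a ≡ a′) → (h : B → Carrier) →
                ∑ (h ∘ g) ≤ ∑ h
  ∑-injection g g-injective h = ∑-reindex {P = Unary.U} (λ _ → yes _) g (λ _ _ → g-injective)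
    (λ a ¬u → contradiction _ ¬u) (λ a _ → ≤-refl)

  ∑-𝟙≡ : ∀ {A} (_≟_ : DecidableEquality A) a (f : A → Carrier) → ∑ (λ x → 𝟙 (x ≡ a) * f x) ≈ f a
  ∑-𝟙≡ _≟_ a f = ≤-antisym (∑-least bound)
    (≤-trans (𝟙-intro ≡.refl) (∑-point (λ x → 𝟙 (x ≡ a) * f x) a))
    where
    vanish : ∀ xs → All (a ≢_) xs → sumOver (λ x → 𝟙 (x ≡ a) * f x) xs ≤ 0#
    vanish []       []           = ≤-refl
    vanish (x ∷ xs) (a≢x ∷ a≢xs) = ≤-trans
      (+-mono (𝟙-false (a≢x ∘ ≡.sym)) (vanish xs a≢xs)) (≤-reflexive (+-identityˡ 0#))
    bound : ∀ xs → Unique xs → sumOver (λ x → 𝟙 (x ≡ a) * f x) xs ≤ f a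
    bound []       _            = 0≤ _
    bound (x ∷ xs) (x∉xs ∷ xs!) with x ≟ a
    ... | yes ≡.refl = ≤-trans (+-mono (𝟙-elim λ _ → ≤-refl) (vanish xs x∉xs))
                               (≤-reflexive (+-identityʳ _))
    ... | no x≢a     = ≤-trans (+-mono (𝟙-false x≢a) (bound xs xs!)) (≤-reflexive (+-identityˡ _))

  module _ {B : Set} (_≟_ : DecidableEquality B) where

    private
      merge : List B → List B → List B
      merge xs ys = deduplicate _≟_ (xs ++ ys)

      merge-! : ∀ xs ys → Unique (merge xs ys)
      merge-! xs ys = deduplicate-! _≟_ (xs ++ ys)

      sumOver-mergeˡ : (f : B → Carrier) → ∀ {xs} ys → Unique xs →
                       sumOver f xs ≤ sumOver f (merge xs ys)
      sumOver-mergeˡ f ys xs! = sumOver-⊆ f xs! λ z∈ → ∈-deduplicate⁺ _≟_ (∈-++⁺ˡ z∈)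

      sumOver-mergeʳ : (f : B → Carrier) → ∀ xs {ys} → Unique ys →
                       sumOver f ys ≤ sumOver f (merge xs ys)
      sumOver-mergeʳ f xs ys! = sumOver-⊆ f ys! λ z∈ → ∈-deduplicate⁺ _≟_ (∈-++⁺ʳ xs z∈)

    -- The finite lists that approximate the two sums may differ, so both are enlarged to a common
    -- list; removing its repetitions takes decidable equality.
    ∑-+-≥ : (f g : B → Carrier) → ∑ f + ∑ g ≤ ∑ λ b → f b + g b
    ∑-+-≥ f g = +-∑-least λ ys ys! → ≤-trans (≤-reflexive (+-comm _ _)) (+-∑-least λ xs xs! → begin
      sumOver g ys + sumOver f xs               ≈⟨ +-comm _ _ ⟩
      sumOver f xs + sumOver g ys               ≤⟨ +-mono (sumOver-mergeˡ f ys xs!)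
                                                           (sumOver-mergeʳ g xs ys!) ⟩
      sumOver f (merge xs ys) + sumOver g (merge xs ys) ≈⟨ sumOver-+ f g (merge xs ys) ⟨
      sumOver (λ b → f b + g b) (merge xs ys)       ≤⟨ sumOver≤∑ (merge-! xs ys) ⟩
      ∑ (λ b → f b + g b)                       ∎)

    -- Finitely many unordered sums are approximated simultaneously: the index sets found
    -- separately are merged.
    sumOver-∑-least : ∀ {A : Set} {y} {f : A → B → Carrier} xs {z} →
      (∀ ys → Unique ys → z + sumOver (λ a → sumOver (f a) ys) xs ≤ y) →
      z + sumOver (λ a → ∑ (f a)) xs ≤ y
    sumOver-∑-least [] h = h [] []
    sumOver-∑-least {y = y} {f} (x ∷ xs) {z} h = begin
      z + (∑ (f x) + rest) ≈⟨ +-Shuffle.x∙yz≈xz∙y z _ _ ⟩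
      (z + rest) + ∑ (f x) ≤⟨ +-∑-least (λ ys₁ ys₁! → ≤-trans
                                (≤-reflexive (+-Shuffle.xy∙z≈xz∙y z rest _))
                                (sumOver-∑-least xs λ ys₂ ys₂! → step ys₁ ys₂ ys₁! ys₂!)) ⟩
      y                    ∎
      where
      rest = sumOver (λ a → ∑ (f a)) xs
      step : ∀ ys₁ ys₂ → Unique ys₁ → Unique ys₂ →
             (z + sumOver (f x) ys₁) + sumOver (λ a → sumOver (f a) ys₂) xs ≤ y
      step ys₁ ys₂ ys₁! ys₂! = ≤-trans (≤-reflexive (+-assoc _ _ _)) (≤-trans
        (+-mono ≤-refl (+-mono (sumOver-mergeˡ (f x) ys₂ ys₁!)
                               (sumOver-mono (λ a → sumOver-mergeʳ (f a) ys₁ ys₂!) xs)))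
        (h (merge ys₁ ys₂) (merge-! ys₁ ys₂)))

    -- Reduces the interchange of sums and the passage to pairs to finite rectangles.
    ∑∑-least : ∀ {A : Set} {y} {f : A → B → Carrier} →
      (∀ xs ys → Unique xs → Unique ys → sumOver (λ a → sumOver (f a) ys) xs ≤ y) →
      ∑ (λ a → ∑ (f a)) ≤ y
    ∑∑-least h = ∑-least λ xs xs! → ≤-trans (≥-reflexive (+-identityˡ _))
      (sumOver-∑-least xs λ ys ys! → ≤-trans (≤-reflexive (+-identityˡ _)) (h xs ys xs! ys!))

    ∑-swap-≤ : ∀ {A : Set} (f : A → B → Carrier) → ∑ (λ a → ∑ (f a)) ≤ ∑ λ b → ∑ λ a → f a b
    ∑-swap-≤ f = ∑∑-least λ xs ys xs! ys! → begin
      sumOver (λ a → sumOver (f a) ys) xs         ≈⟨ sumOver-swap f xs ys ⟩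
      sumOver (λ b → sumOver (λ a → f a b) xs) ys ≤⟨ sumOver-mono (λ b → sumOver≤∑ xs!) ys ⟩
      sumOver (λ b → ∑ λ a → f a b) ys            ≤⟨ sumOver≤∑ ys! ⟩
      ∑ (λ b → ∑ λ a → f a b)                     ∎

    ∑∑≤∑-× : ∀ {A : Set} (f : A × B → Carrier) → ∑ (λ a → ∑ λ b → f (a , b)) ≤ ∑ f
    ∑∑≤∑-× f = ∑∑-least λ xs ys xs! ys! → ≤-trans
      (≥-reflexive (sumOver-cartesianProduct f xs ys)) (sumOver≤∑ (cartesianProduct⁺ xs! ys!))

    -- A finite set of pairs lies in the rectangle spanned by its two projections.
    ∑-×≤∑∑ : ∀ {A : Set} → DecidableEquality A → (f : A × B → Carrier) →
             ∑ f ≤ ∑ λ a → ∑ λ b → f (a , b)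
    ∑-×≤∑∑ _≟ᴬ_ f = ∑-least λ ps ps! → let
        xs = deduplicate _≟ᴬ_ (map proj₁ ps)
        ys = deduplicate _≟_ (map proj₂ ps)
      in begin
        sumOver f ps
          ≤⟨ sumOver-⊆ f ps! (λ p∈ps → ∈-cartesianProduct⁺
               (∈-deduplicate⁺ _≟ᴬ_ (∈-map⁺ proj₁ p∈ps)) (∈-deduplicate⁺ _≟_ (∈-map⁺ proj₂ p∈ps))) ⟩
        sumOver f (cartesianProduct xs ys)
          ≈⟨ sumOver-cartesianProduct f xs ys ⟩
        sumOver (λ a → sumOver (λ b → f (a , b)) ys) xs
          ≤⟨ sumOver-mono (λ a → sumOver≤∑ (deduplicate-! _≟_ (map proj₂ ps))) xs ⟩
        sumOver (λ a → ∑ λ b → f (a , b)) xs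
          ≤⟨ sumOver≤∑ (deduplicate-! _≟ᴬ_ (map proj₁ ps)) ⟩
        ∑ (λ a → ∑ λ b → f (a , b)) ∎

  ∑-swap : ∀ {A B} → DecidableEquality A → DecidableEquality B → (f : A → B → Carrier) →
           ∑ (λ a → ∑ (f a)) ≈ ∑ λ b → ∑ λ a → f a b
  ∑-swap _≟ᴬ_ _≟ᴮ_ f = ≤-antisym (∑-swap-≤ _≟ᴮ_ f) (∑-swap-≤ _≟ᴬ_ λ b a → f a b)

  -- Finite products

  ∏ : ∀ {k} → (Fin k → Carrier) → Carrier
  ∏ = Vector.foldr _*_ 1#

  ∏-mono : ∀ {k} {f g : Fin k → Carrier} → (∀ i → f i ≤ g i) → ∏ f ≤ ∏ g
  ∏-mono {ℕ.zero}  f≤g = ≤-refl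
  ∏-mono {ℕ.suc k} f≤g = *-mono (f≤g zero) (∏-mono (f≤g ∘ suc))

  ∏-cong : ∀ {k} {f g : Fin k → Carrier} → (∀ i → f i ≈ g i) → ∏ f ≈ ∏ g
  ∏-cong f≈g = ≤-antisym (∏-mono (≤-reflexive ∘ f≈g)) (∏-mono (≥-reflexive ∘ f≈g))

  ∏-* : ∀ {k} (f g : Fin k → Carrier) → ∏ (λ i → f i * g i) ≈ ∏ f * ∏ g
  ∏-* {ℕ.zero}  f g = sym (*-identityˡ 1#)
  ∏-* {ℕ.suc k} f g =
    trans (*-congˡ (∏-* (f ∘ suc) (g ∘ suc))) (*-Shuffle.interchange _ _ _ _)

-- Redrawing variables

module Redraw (R : SummableSemiring) where
  open Summation R public

  Marginals : ℕ → Set₁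
  Marginals n = Fin n → Σ[ p ∈ (ℤ → Carrier) ] ∑ p ≈ 1#

  _≟ᶜ_ : ∀ {n} → DecidableEquality (Config n)
  _≟ᶜ_ = Vec.≡-dec ℤ._≟_

  -- Coordinates that stay fixed carry an indicator, in exactly the form of `resample`, so that the
  -- two agree by definition when `S` is `vars E`.
  kernel : ∀ {n} → Marginals n → Subset n → Config n → Config n → Carrier
  kernel ω S x y = ∏ λ i →
    if lookup S i then proj₁ (ω i) (lookup y i) else 𝟙 (lookup y i ≡ lookup x i)

  -- The conditional expectation of f given the variables outside S.
  redraw : ∀ {n} → Marginals n → Subset n → (Config n → Carrier) → Config n → Carrier
  redraw ω S f x = ∑ λ y → kernel ω S x y * f y

  module _ {n} (ω : Marginals n) (S : Subset n) where

    redraw-mono : ∀ {f g} → (∀ y → f y ≤ g y) → ∀ x → redraw ω S f x ≤ redraw ω S g x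
    redraw-mono f≤g x = ∑-mono λ y → *-mono ≤-refl (f≤g y)

    redraw-cong : ∀ {f g} → (∀ y → f y ≈ g y) → ∀ x → redraw ω S f x ≈ redraw ω S g x
    redraw-cong f≈g x = ∑-cong λ y → *-congˡ (f≈g y)

    redraw-*ˡ : ∀ k f x → redraw ω S (λ y → k * f y) x ≈ k * redraw ω S f x
    redraw-*ˡ k f x =
      trans (∑-cong λ y → *-Shuffle.x∙yz≈y∙xz _ k _) (sym (*-distribˡ-∑ k _))

    redraw-+-≤ : ∀ f g x → redraw ω S (λ y → f y + g y) x ≤ redraw ω S f x + redraw ω S g x
    redraw-+-≤ f g x = ≤-trans (∑-mono λ y → ≤-reflexive (distribˡ _ _ _)) (∑-+-≤ _ _)

    redraw-∑ : ∀ {A} → DecidableEquality A → (f : A → Config n → Carrier) → ∀ x →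
               redraw ω S (λ y → ∑ λ a → f a y) x ≈ ∑ λ a → redraw ω S (f a) x
    redraw-∑ _≟_ f x =
      trans (∑-cong λ y → *-distribˡ-∑ _ _) (∑-swap _≟ᶜ_ _≟_ _)

  ∑-∷ : ∀ {n} (f : Config (ℕ.suc n) → Carrier) → ∑ f ≈ ∑ λ v → ∑ λ y → f (v ∷ y)
  ∑-∷ f = ≤-antisym
    (begin
      ∑ f                         ≤⟨ ∑-mono (λ { (v ∷ y) → ≤-refl }) ⟩
      ∑ (f′ ∘ Vec.uncons)         ≤⟨ ∑-injection Vec.uncons
                                       (λ { {_ ∷ _} {_ ∷ _} ≡.refl → ≡.refl }) f′ ⟩
      ∑ f′                        ≤⟨ ∑-×≤∑∑ _≟ᶜ_ ℤ._≟_ f′ ⟩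
      ∑ (λ v → ∑ λ y → f (v ∷ y)) ∎)
    (≤-trans (∑∑≤∑-× _≟ᶜ_ f′) (∑-injection (λ (v , y) → v ∷ y) (λ { ≡.refl → ≡.refl }) f))
    where
    f′ : ℤ × Config _ → Carrier
    f′ (v , y) = f (v ∷ y)

  redraw-[] : ∀ (ω : Marginals 0) f → redraw ω [] f [] ≈ f []
  redraw-[] ω f = trans
    (∑-cong λ { [] → *-congʳ (≤-antisym (𝟙-true ≡.refl) 𝟙≤1) })
    (∑-𝟙≡ _≟ᶜ_ [] f)

  module _ {n} (ω : Marginals (ℕ.suc n)) (S : Subset n) where

    -- The head coordinate is averaged out here and held fixed in the next equation. Through these
    -- two, the later facts about `redraw` are inductions on the number of variables.
    redraw-inside : ∀ f u x → redraw ω (inside ∷ S) f (u ∷ x) ≈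
      ∑ λ v → proj₁ (ω zero) v * redraw (ω ∘ suc) S (λ y → f (v ∷ y)) x
    redraw-inside f u x = trans (∑-∷ _) (∑-cong λ v →
      trans (∑-cong λ y → *-assoc _ _ _) (sym (*-distribˡ-∑ _ _)))

    redraw-outside : ∀ f u x → redraw ω (outside ∷ S) f (u ∷ x) ≈
      redraw (ω ∘ suc) S (λ y → f (u ∷ y)) x
    redraw-outside f u x = trans (∑-∷ _) (trans
      (∑-cong λ v → trans (∑-cong λ y → *-assoc _ _ _) (sym (*-distribˡ-∑ _ _)))
      (∑-𝟙≡ ℤ._≟_ u _))

  average-const : (p : Σ[ p ∈ (ℤ → Carrier) ] ∑ p ≈ 1#) → ∀ k → ∑ (λ v → proj₁ p v * k) ≈ k
  average-const (p , total) k =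
    trans (sym (*-distribʳ-∑ k p)) (trans (*-congʳ total) (*-identityˡ k))

  redraw-const : ∀ {n} (ω : Marginals n) S k x → redraw ω S (λ _ → k) x ≈ k
  redraw-const ω []            k []      = redraw-[] ω _
  redraw-const ω (inside  ∷ S) k (u ∷ x) = trans (redraw-inside ω S _ u x)
    (trans (∑-cong λ v → *-congˡ (redraw-const (ω ∘ suc) S k x)) (average-const (ω zero) k))
  redraw-const ω (outside ∷ S) k (u ∷ x) =
    trans (redraw-outside ω S _ u x) (redraw-const (ω ∘ suc) S k x)

  Disjoint : ∀ {n} → Subset n → Subset n → Set
  Disjoint S T = ∀ i → i ∈ S → i ∈ T → ⊥

  Disjoint-tail : ∀ {n s t} {S T : Subset n} → Disjoint (s ∷ S) (t ∷ T) → Disjoint S T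
  Disjoint-tail disjoint i i∈S i∈T = disjoint (suc i) (there i∈S) (there i∈T)

  -- Fubini, coordinate by coordinate: by disjointness no coordinate is redrawn twice. When exactly
  -- one side redraws the head, its average is carried through the other side by linearity.
  redraw-comm : ∀ {n} (ω : Marginals n) S T → Disjoint S T → ∀ f x →
                redraw ω S (redraw ω T f) x ≈ redraw ω T (redraw ω S f) x

  redraw-comm-head : ∀ {n} (ω : Marginals (ℕ.suc n)) S T → Disjoint S T → ∀ f x →
    redraw ω (inside ∷ S) (redraw ω (outside ∷ T) f) x ≈
    redraw ω (outside ∷ T) (redraw ω (inside ∷ S) f) x
  redraw-comm-head ω S T disjoint f (u ∷ x) = begin-equality
    redraw ω (inside ∷ S) (redraw ω (outside ∷ T) f) (u ∷ x)
      ≈⟨ redraw-inside ω S _ u x ⟩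
    ∑ (λ v → p v * redraw ω′ S (λ y → redraw ω (outside ∷ T) f (v ∷ y)) x)
      ≈⟨ ∑-cong (λ v → *-congˡ (redraw-cong ω′ S (λ y → redraw-outside ω T f v y) x)) ⟩
    ∑ (λ v → p v * redraw ω′ S (redraw ω′ T (λ y → f (v ∷ y))) x)
      ≈⟨ ∑-cong (λ v → *-congˡ (redraw-comm ω′ S T disjoint _ x)) ⟩
    ∑ (λ v → p v * redraw ω′ T (redraw ω′ S (λ y → f (v ∷ y))) x)
      ≈⟨ ∑-cong (λ v → redraw-*ˡ ω′ T _ _ x) ⟨
    ∑ (λ v → redraw ω′ T (λ y → p v * redraw ω′ S (λ z → f (v ∷ z)) y) x)
      ≈⟨ redraw-∑ ω′ T ℤ._≟_ _ x ⟨
    redraw ω′ T (λ y → ∑ λ v → p v * redraw ω′ S (λ z → f (v ∷ z)) y) x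
      ≈⟨ redraw-cong ω′ T (λ y → redraw-inside ω S f u y) x ⟨
    redraw ω′ T (λ y → redraw ω (inside ∷ S) f (u ∷ y)) x
      ≈⟨ redraw-outside ω T _ u x ⟨
    redraw ω (outside ∷ T) (redraw ω (inside ∷ S) f) (u ∷ x) ∎
    where
    p  = proj₁ (ω zero)
    ω′ = ω ∘ suc

  redraw-comm ω [] [] _ f x = refl
  redraw-comm ω (inside  ∷ S) (inside  ∷ T) disjoint f x with () ← disjoint zero here here
  redraw-comm ω (inside  ∷ S) (outside ∷ T) disjoint f x =
    redraw-comm-head ω S T (Disjoint-tail disjoint) f x
  redraw-comm ω (outside ∷ S) (inside  ∷ T) disjoint f x =
    sym (redraw-comm-head ω T S (λ i i∈T i∈S → Disjoint-tail disjoint i i∈S i∈T) f x)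
  redraw-comm ω (outside ∷ S) (outside ∷ T) disjoint f (u ∷ x) = begin-equality
    redraw ω (outside ∷ S) (redraw ω (outside ∷ T) f) (u ∷ x)
      ≈⟨ redraw-outside² S T ⟩
    redraw ω′ S (redraw ω′ T (λ y → f (u ∷ y))) x
      ≈⟨ redraw-comm ω′ S T (Disjoint-tail disjoint) _ x ⟩
    redraw ω′ T (redraw ω′ S (λ y → f (u ∷ y))) x
      ≈⟨ redraw-outside² T S ⟨
    redraw ω (outside ∷ T) (redraw ω (outside ∷ S) f) (u ∷ x) ∎
    where
    ω′ = ω ∘ suc
    redraw-outside² : ∀ S T → redraw ω (outside ∷ S) (redraw ω (outside ∷ T) f) (u ∷ x) ≈
                              redraw ω′ S (redraw ω′ T (λ y → f (u ∷ y))) x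
    redraw-outside² S T = trans (redraw-outside ω S _ u x)
      (redraw-cong ω′ S (λ y → redraw-outside ω T f u y) x)

  DependsOn : ∀ {n} → Subset n → (Config n → Carrier) → Set₁
  DependsOn V g = ∀ x y → (∀ i → i ∈ V → lookup x i ≡ lookup y i) → g x ≡ g y

  DependsOn-tail : ∀ {n v} {V : Subset n} {g} → DependsOn (v ∷ V) g →
                   ∀ u → DependsOn V (λ y → g (u ∷ y))
  DependsOn-tail dep u x y eq = dep (u ∷ x) (u ∷ y)
    λ { zero _ → ≡.refl ; (suc i) (there i∈V) → eq i i∈V }

  DependsOn-outside : ∀ {n} {V : Subset n} {g} → DependsOn (outside ∷ V) g →
                      ∀ u v y → g (u ∷ y) ≡ g (v ∷ y)
  DependsOn-outside dep u v y = dep (u ∷ y) (v ∷ y) λ { (suc i) _ → ≡.refl }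

  -- Taking out what is known: `g` reads no redrawn variable, so it is a constant under the average.
  redraw-pullˡ : ∀ {n} (ω : Marginals n) S V → Disjoint S V → ∀ {g} → DependsOn V g → ∀ f x →
                 redraw ω S (λ y → g y * f y) x ≈ g x * redraw ω S f x
  redraw-pullˡ ω [] [] _ {g} dep f [] =
    trans (redraw-[] ω _) (*-congˡ {g []} (sym (redraw-[] ω f)))
  redraw-pullˡ ω (inside ∷ S) (inside ∷ V) disjoint _ f x with () ← disjoint zero here here
  redraw-pullˡ ω (inside ∷ S) (outside ∷ V) disjoint {g} dep f (u ∷ x) = begin-equality
    redraw ω (inside ∷ S) (λ y → g y * f y) (u ∷ x)
      ≈⟨ redraw-inside ω S _ u x ⟩
    ∑ (λ v → p v * redraw (ω ∘ suc) S (λ y → g (v ∷ y) * f (v ∷ y)) x)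
      ≈⟨ ∑-cong (λ v → *-congˡ (redraw-pullˡ (ω ∘ suc) S V (Disjoint-tail disjoint)
           (DependsOn-tail dep v) _ x)) ⟩
    ∑ (λ v → p v * (g (v ∷ x) * redraw (ω ∘ suc) S (λ y → f (v ∷ y)) x))
      ≈⟨ ∑-cong (λ v → *-congˡ (*-congʳ (reflexive (DependsOn-outside dep v u x)))) ⟩
    ∑ (λ v → p v * (g (u ∷ x) * redraw (ω ∘ suc) S (λ y → f (v ∷ y)) x))
      ≈⟨ ∑-cong (λ v → *-Shuffle.x∙yz≈y∙xz _ _ _) ⟩
    ∑ (λ v → g (u ∷ x) * (p v * redraw (ω ∘ suc) S (λ y → f (v ∷ y)) x))
      ≈⟨ *-distribˡ-∑ _ _ ⟨
    g (u ∷ x) * ∑ (λ v → p v * redraw (ω ∘ suc) S (λ y → f (v ∷ y)) x)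
      ≈⟨ *-congˡ (redraw-inside ω S f u x) ⟨
    g (u ∷ x) * redraw ω (inside ∷ S) f (u ∷ x) ∎
    where p = proj₁ (ω zero)
  redraw-pullˡ ω (outside ∷ S) (v ∷ V) disjoint dep f (u ∷ x) =
    trans (redraw-outside ω S _ u x) (trans
      (redraw-pullˡ (ω ∘ suc) S V (Disjoint-tail disjoint) (DependsOn-tail dep u) _ x)
      (*-congˡ (sym (redraw-outside ω S f u x))))

  -- After the redraw `f` sees fresh values on `S`, while `g` reads only the old ones there; the two
  -- factors are therefore independent under the full average, and the redraw does not change the
  -- mean of `f`.
  redraw-independent : ∀ {n} (ω : Marginals n) S {g} → DependsOn S g → ∀ f x →
    redraw ω ⊤ (λ y → g y * redraw ω S f y) x ≈ redraw ω ⊤ g x * redraw ω ⊤ f x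
  redraw-independent ω [] {g} _ f [] =
    trans (redraw-[] ω _) (*-congʳ {redraw ω [] f []} (sym (redraw-[] ω g)))
  redraw-independent {ℕ.suc n} ω (inside ∷ S) {g} dep f (u ∷ x) = begin-equality
    redraw ω ⊤ (λ y → g y * redraw ω (inside ∷ S) f y) (u ∷ x)
      ≈⟨ redraw-inside ω ⊤ _ u x ⟩
    ∑ (λ v → p v * redraw ω′ ⊤ (λ y → g (v ∷ y) * redraw ω (inside ∷ S) f (v ∷ y)) x)
      ≈⟨ ∑-cong (λ v → *-congˡ (inner v)) ⟩
    ∑ (λ v → p v * (𝔼 (λ y → g (v ∷ y)) * redraw ω ⊤ f (u ∷ x)))
      ≈⟨ ∑-cong (λ v → *-assoc _ _ _) ⟨
    ∑ (λ v → p v * 𝔼 (λ y → g (v ∷ y)) * redraw ω ⊤ f (u ∷ x))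
      ≈⟨ *-distribʳ-∑ _ _ ⟨
    ∑ (λ v → p v * 𝔼 (λ y → g (v ∷ y))) * redraw ω ⊤ f (u ∷ x)
      ≈⟨ *-congʳ (redraw-inside ω ⊤ g u x) ⟨
    redraw ω ⊤ g (u ∷ x) * redraw ω ⊤ f (u ∷ x) ∎
    where
    p  = proj₁ (ω zero)
    ω′ = ω ∘ suc
    𝔼 : (Config n → Carrier) → Carrier
    𝔼 h = redraw ω′ ⊤ h x
    -- `v` is the head value that `g` reads and `w` the fresh one that `f` reads; they are averaged
    -- separately.
    inner : ∀ v → 𝔼 (λ y → g (v ∷ y) * redraw ω (inside ∷ S) f (v ∷ y)) ≈
                  𝔼 (λ y → g (v ∷ y)) * redraw ω ⊤ f (u ∷ x)
    inner v = begin-equality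
      𝔼 (λ y → g (v ∷ y) * redraw ω (inside ∷ S) f (v ∷ y))
        ≈⟨ redraw-cong ω′ ⊤ (λ y → trans (*-congˡ (redraw-inside ω S f v y))
             (trans (*-distribˡ-∑ _ _) (∑-cong λ w → *-Shuffle.x∙yz≈y∙xz _ _ _))) x ⟩
      𝔼 (λ y → ∑ λ w → p w * (g (v ∷ y) * redraw ω′ S (λ z → f (w ∷ z)) y))
        ≈⟨ redraw-∑ ω′ ⊤ ℤ._≟_ _ x ⟩
      ∑ (λ w → 𝔼 (λ y → p w * (g (v ∷ y) * redraw ω′ S (λ z → f (w ∷ z)) y)))
        ≈⟨ ∑-cong (λ w → redraw-*ˡ ω′ ⊤ _ _ x) ⟩
      ∑ (λ w → p w * 𝔼 (λ y → g (v ∷ y) * redraw ω′ S (λ z → f (w ∷ z)) y))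
        ≈⟨ ∑-cong (λ w → *-congˡ (redraw-independent ω′ S (DependsOn-tail dep v) _ x)) ⟩
      ∑ (λ w → p w * (𝔼 (λ y → g (v ∷ y)) * 𝔼 (λ z → f (w ∷ z))))
        ≈⟨ ∑-cong (λ w → *-Shuffle.x∙yz≈y∙xz _ _ _) ⟩
      ∑ (λ w → 𝔼 (λ y → g (v ∷ y)) * (p w * 𝔼 (λ z → f (w ∷ z))))
        ≈⟨ *-distribˡ-∑ _ _ ⟨
      𝔼 (λ y → g (v ∷ y)) * ∑ (λ w → p w * 𝔼 (λ z → f (w ∷ z)))
        ≈⟨ *-congˡ (redraw-inside ω ⊤ f u x) ⟨
      𝔼 (λ y → g (v ∷ y)) * redraw ω ⊤ f (u ∷ x) ∎
  redraw-independent {ℕ.suc n} ω (outside ∷ S) {g} dep f (u ∷ x) = begin-equality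
    redraw ω ⊤ (λ y → g y * redraw ω (outside ∷ S) f y) (u ∷ x)
      ≈⟨ redraw-inside ω ⊤ _ u x ⟩
    ∑ (λ v → p v * 𝔼 (λ y → g (v ∷ y) * redraw ω (outside ∷ S) f (v ∷ y)))
      ≈⟨ ∑-cong (λ v → *-congˡ (redraw-cong ω′ ⊤ (λ y → *-congˡ (redraw-outside ω S f v y)) x)) ⟩
    ∑ (λ v → p v * 𝔼 (λ y → g (v ∷ y) * redraw ω′ S (λ z → f (v ∷ z)) y))
      ≈⟨ ∑-cong (λ v → *-congˡ (redraw-independent ω′ S (DependsOn-tail dep v) _ x)) ⟩
    ∑ (λ v → p v * (𝔼 (λ y → g (v ∷ y)) * 𝔼 (λ z → f (v ∷ z))))
      ≈⟨ ∑-cong (λ v → *-congˡ (*-congʳ (g-head v))) ⟩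
    ∑ (λ v → p v * (𝔼 (λ y → g (u ∷ y)) * 𝔼 (λ z → f (v ∷ z))))
      ≈⟨ ∑-cong (λ v → *-Shuffle.x∙yz≈y∙xz _ _ _) ⟩
    ∑ (λ v → 𝔼 (λ y → g (u ∷ y)) * (p v * 𝔼 (λ z → f (v ∷ z))))
      ≈⟨ *-distribˡ-∑ _ _ ⟨
    𝔼 (λ y → g (u ∷ y)) * ∑ (λ v → p v * 𝔼 (λ z → f (v ∷ z)))
      ≈⟨ *-cong (trans (redraw-inside ω ⊤ g u x) (trans (∑-cong λ v → *-congˡ (g-head v))
           (average-const (ω zero) _))) (redraw-inside ω ⊤ f u x) ⟨
    redraw ω ⊤ g (u ∷ x) * redraw ω ⊤ f (u ∷ x) ∎
    where
    p  = proj₁ (ω zero)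
    ω′ = ω ∘ suc
    𝔼 : (Config n → Carrier) → Carrier
    𝔼 h = redraw ω′ ⊤ h x
    -- Here `g` does not read the head, so its factor can be fixed at `u` and the average over `v`
    -- falls on `f` alone.
    g-head : ∀ v → 𝔼 (λ y → g (v ∷ y)) ≈ 𝔼 (λ y → g (u ∷ y))
    g-head v = redraw-cong ω′ ⊤ (λ y → reflexive (DependsOn-outside dep v u y)) x

-- Stable sequences

module _ {n : ℕ} where

  ∼-refl : (E : Event n) → E ∼ E
  ∼-refl E = inj₁ (≡.refl , λ _ → ≡.refl)

  ∼-sym : (E F : Event n) → E ∼ F → F ∼ E
  ∼-sym E F (inj₁ (eq , h)) = inj₁ (≡.sym eq , λ x → ≡.sym (h x))
  ∼-sym E F (inj₂ shared)   = inj₂ (≡.subst Subset.Nonempty (∩-comm (vars E) (vars F)) shared)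

  -- An event without variables is determined by its value at a single configuration.
  _∼?_ : (E F : Event n) → Dec (E ∼ F)
  E ∼? F with nonempty? (vars E ∩ vars F) | Vec.≡-dec Bool._≟_ (vars E) (vars F)
  ... | yes shared | _        = yes (inj₂ shared)
  ... | no  ¬shared | no  vE≢vF = no λ
    { (inj₁ (eq , _)) → vE≢vF eq ; (inj₂ shared) → ¬shared shared }
  ... | no  ¬shared | yes vE≡vF with holds E (replicate n 0ℤ) Bool.≟ holds F (replicate n 0ℤ)
  ...   | no  E≢F = no λ { (inj₁ (_ , h)) → E≢F (h _) ; (inj₂ shared) → ¬shared shared }
  ...   | yes E≡F = yes (inj₁ (vE≡vF , λ x → ≡.trans
            (local E x _ λ i i∈E →
              contradiction (i , x∈p∩q⁺ (i∈E , ≡.subst (i ∈_) vE≡vF i∈E)) ¬shared)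
            (≡.trans E≡F
            (local F _ x λ i i∈F →
              contradiction (i , x∈p∩q⁺ (≡.subst (i ∈_) (≡.sym vE≡vF) i∈F , i∈F)) ¬shared))))

-- Insertion into subsets, and subsets cut out by decidable predicates

module _ {m : ℕ} where

  ∈-insert : (J : Subset m) (c : Fin m) → c ∈ J [ c ]≔ inside
  ∈-insert J c = Vec.lookup⇒[]= c _ (Vec.lookup∘updateAt c J)

  ∈-insert⁺ : (J : Subset m) (c : Fin m) → ∀ {b} → b ∈ J → b ∈ J [ c ]≔ inside
  ∈-insert⁺ J c {b} b∈J with b Fin.≟ c
  ... | yes ≡.refl = ∈-insert J c
  ... | no  b≢c    = Vec.lookup⇒[]= b _ (≡.trans (Vec.lookup∘updateAt′ b c b≢c J)
                                                 (Vec.[]=⇒lookup b∈J))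

  ∈-insert⁻ : (J : Subset m) (c : Fin m) → ∀ {b} → b ∈ J [ c ]≔ inside → b ≡ c ⊎ b ∈ J
  ∈-insert⁻ J c {b} b∈ with b Fin.≟ c
  ... | yes b≡c = inj₁ b≡c
  ... | no  b≢c = inj₂ (Vec.lookup⇒[]= b _
                    (≡.trans (≡.sym (Vec.lookup∘updateAt′ b c b≢c J)) (Vec.[]=⇒lookup b∈)))

  delete-insert : ∀ {J : Subset m} {c} → c ∉ J → (J [ c ]≔ inside) [ c ]≔ outside ≡ J
  delete-insert {J} {c} c∉J with lookup J c in eq
  ... | true  = contradiction (Vec.lookup⇒[]= c J eq) c∉J
  ... | false = ≡.trans (Vec.[]≔-idempotent J c)
                  (≡.trans (≡.cong (J [ c ]≔_) (≡.sym eq)) (Vec.[]≔-lookup J c))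

  insert-injective : ∀ {I J : Subset m} {c} → c ∉ I → c ∉ J →
                     I [ c ]≔ inside ≡ J [ c ]≔ inside → I ≡ J
  insert-injective {c = c} c∉I c∉J eq =
    ≡.trans (≡.sym (delete-insert c∉I)) (≡.trans (≡.cong (_[ c ]≔ outside) eq) (delete-insert c∉J))

  partition-∩ : (I S : Subset m) → (I ∩ S) ∪ (I ∩ ∁ S) ≡ I
  partition-∩ I S = ≡.trans (≡.sym (∩-distribˡ-∪ I S (∁ S)))
    (≡.trans (≡.cong (I ∩_) (∪-inverseʳ S)) (∩-identityʳ I))

  ⟦_⟧ : {K : Fin m → Set} → Unary.Decidable K → Subset m
  ⟦ K? ⟧ = tabulate (does ∘ K?)

  ∈⟦⟧⁻ : {K : Fin m → Set} (K? : Unary.Decidable K) → ∀ {b} → b ∈ ⟦ K? ⟧ → K b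
  ∈⟦⟧⁻ K? {b} b∈ with K? b | ≡.trans (≡.sym (Vec.lookup∘tabulate (does ∘ K?) b)) (Vec.[]=⇒lookup b∈)
  ... | yes k | _ = k

  ∈⟦⟧⁺ : {K : Fin m → Set} (K? : Unary.Decidable K) → ∀ {b} → K b → b ∈ ⟦ K? ⟧
  ∈⟦⟧⁺ K? {b} k with K? b | Vec.lookup∘tabulate (does ∘ K?) b
  ... | yes _ | eq = Vec.lookup⇒[]= b _ eq
  ... | no ¬k | _ = contradiction k ¬k

-- The operators `fire` and their products over sets

module Layers (R : SummableSemiring) {n m : ℕ} (ω : Redraw.Marginals R n) (𝓑 : BadEvents n m) where
  open Redraw R public

  _≟ˢ_ : DecidableEquality (Subset m)
  _≟ˢ_ = Vec.≡-dec Bool._≟_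

  ∑-+ : (f g : Subset m → Carrier) → ∑ (λ J → f J + g J) ≈ ∑ f + ∑ g
  ∑-+ f g = ≤-antisym (∑-+-≤ f g) (∑-+-≥ _≟ˢ_ f g)

  infix 4 _⊑_
  _⊑_ : (f g : Config n → Carrier) → Set
  f ⊑ g = ∀ x → f x ≤ g x

  ⟪_⟫ : Event n → Config n → Carrier
  ⟪ E ⟫ x = 𝟙 (x ⊨ E)

  ⟪⟫-local : ∀ E → DependsOn (vars E) ⟪ E ⟫
  ⟪⟫-local E x y eq = ≡.cong (𝟙 ∘ T) (local E x y eq)

  fire : Event n → (Config n → Carrier) → Config n → Carrier
  fire E f x = ⟪ E ⟫ x * redraw ω (vars E) f x

  ≁⇒Disjoint : ∀ (E F : Event n) → ¬ E ∼ F → Disjoint (vars E) (vars F)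
  ≁⇒Disjoint E F E≁F i i∈E i∈F = E≁F (inj₂ (i , x∈p∩q⁺ (i∈E , i∈F)))

  module _ (E : Event n) where

    fire-mono : ∀ {f g} → f ⊑ g → fire E f ⊑ fire E g
    fire-mono f⊑g x = *-monoʳ (redraw-mono ω (vars E) f⊑g x)

    fire-+ : ∀ f g x → fire E (λ y → f y + g y) x ≤ fire E f x + fire E g x
    fire-+ f g x = ≤-trans (*-monoʳ (redraw-+-≤ ω (vars E) f g x)) (≤-reflexive (distribˡ _ _ _))

    fire-*ˡ : ∀ k f x → fire E (λ y → k * f y) x ≈ k * fire E f x
    fire-*ˡ k f x = trans (*-congˡ (redraw-*ˡ ω (vars E) k f x)) (*-Shuffle.x∙yz≈y∙xz _ k _)

    fire-∑ : (k : Subset m → Carrier) (f : Subset m → Config n → Carrier) → ∀ x →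
             fire E (λ y → ∑ λ J → k J * f J y) x ≤ ∑ λ J → k J * fire E (f J) x
    fire-∑ k f x = ≤-reflexive (trans
      (*-congˡ (trans (redraw-∑ ω (vars E) _≟ˢ_ _ x) (∑-cong λ J → redraw-*ˡ ω (vars E) _ _ x)))
      (trans (*-distribˡ-∑ _ _) (∑-cong λ J → *-Shuffle.x∙yz≈y∙xz _ _ _)))

    fire-0 : ∀ {y} x → fire E (λ _ → 0#) x ≤ y
    fire-0 x = ≤-trans
      (≤-reflexive (trans (*-congˡ (redraw-const ω (vars E) 0# x)) (zeroʳ _))) (0≤ _)

  -- Unrelated events share no variable, so each indicator leaves the other's average, and the two
  -- averages commute.
  fire-comm : ∀ E F → ¬ E ∼ F → ∀ f x → fire E (fire F f) x ≤ fire F (fire E f) x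
  fire-comm E F E≁F f x = ≤-reflexive (begin-equality
    ⟪ E ⟫ x * redraw ω (vars E) (λ y → ⟪ F ⟫ y * redraw ω (vars F) f y) x
      ≈⟨ *-congˡ (redraw-pullˡ ω _ _ (≁⇒Disjoint E F E≁F) (⟪⟫-local F) _ x) ⟩
    ⟪ E ⟫ x * (⟪ F ⟫ x * redraw ω (vars E) (redraw ω (vars F) f) x)
      ≈⟨ *-Shuffle.x∙yz≈y∙xz _ _ _ ⟩
    ⟪ F ⟫ x * (⟪ E ⟫ x * redraw ω (vars E) (redraw ω (vars F) f) x)
      ≈⟨ *-congˡ (*-congˡ (redraw-comm ω _ _ (≁⇒Disjoint E F E≁F) f x)) ⟩
    ⟪ F ⟫ x * (⟪ E ⟫ x * redraw ω (vars F) (redraw ω (vars E) f) x)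
      ≈⟨ *-congˡ (redraw-pullˡ ω _ _ (≁⇒Disjoint F E (E≁F ∘ ∼-sym F E)) (⟪⟫-local E) _ x) ⟨
    ⟪ F ⟫ x * redraw ω (vars F) (λ y → ⟪ E ⟫ y * redraw ω (vars E) f y) x ∎)

  -- Redrawing variables foreign to `F` cannot change whether `F` holds, and the indicator of `E` is
  -- at most one. This is how a resampling unrelated to everything after it disappears from the
  -- bound.
  fire-⟪⟫ : ∀ E F → ¬ E ∼ F → fire E ⟪ F ⟫ ⊑ ⟪ F ⟫
  fire-⟪⟫ E F E≁F x = begin
    ⟪ E ⟫ x * redraw ω (vars E) ⟪ F ⟫ x
      ≤⟨ *-mono 𝟙≤1 ≤-refl ⟩
    1# * redraw ω (vars E) ⟪ F ⟫ x
      ≈⟨ *-identityˡ _ ⟩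
    redraw ω (vars E) ⟪ F ⟫ x
      ≈⟨ redraw-cong ω (vars E) (λ y → sym (*-identityʳ _)) x ⟩
    redraw ω (vars E) (λ y → ⟪ F ⟫ y * 1#) x
      ≈⟨ redraw-pullˡ ω _ _ (≁⇒Disjoint E F E≁F) (⟪⟫-local F) _ x ⟩
    ⟪ F ⟫ x * redraw ω (vars E) (λ _ → 1#) x
      ≈⟨ trans (*-congˡ (redraw-const ω (vars E) 1# x)) (*-identityʳ _) ⟩
    ⟪ F ⟫ x ∎

  -- The operators are applied in index order; the sets of interest are independent, so their
  -- operators commute. The family `e` is arbitrary so that the recursion can shift to `e ∘ suc`.
  fireAll : ∀ {k} → (Fin k → Event n) → Subset k → (Config n → Carrier) → Config n → Carrier
  fireAll e []            f = f
  fireAll e (inside  ∷ J) f = fire (e zero) (fireAll (e ∘ suc) J f)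
  fireAll e (outside ∷ J) f = fireAll (e ∘ suc) J f

  fireAll-mono : ∀ {k} (e : Fin k → Event n) J {f g} → f ⊑ g → fireAll e J f ⊑ fireAll e J g
  fireAll-mono e []            f⊑g = f⊑g
  fireAll-mono e (inside  ∷ J) f⊑g = fire-mono (e zero) (fireAll-mono (e ∘ suc) J f⊑g)
  fireAll-mono e (outside ∷ J) f⊑g = fireAll-mono (e ∘ suc) J f⊑g

  fireAll-∅ : ∀ {k} (e : Fin k → Event n) f → fireAll e Subset.⊥ f ≡ f
  fireAll-∅ {ℕ.zero}  e f = ≡.refl
  fireAll-∅ {ℕ.suc k} e f = fireAll-∅ (e ∘ suc) f

  fireAll-comm : ∀ {k} (e : Fin k → Event n) J E → (∀ b → b ∈ J → ¬ E ∼ e b) → ∀ f →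
                 fire E (fireAll e J f) ⊑ fireAll e J (fire E f)
  fireAll-comm e []            E E≁ f x = ≤-refl
  fireAll-comm e (inside  ∷ J) E E≁ f x = ≤-trans (fire-comm E (e zero) (E≁ zero here) _ x)
    (fire-mono (e zero) (fireAll-comm (e ∘ suc) J E (λ b b∈J → E≁ (suc b) (there b∈J)) f) x)
  fireAll-comm e (outside ∷ J) E E≁ f x =
    fireAll-comm (e ∘ suc) J E (λ b b∈J → E≁ (suc b) (there b∈J)) f x

  -- `fire (e c)` passes the members of smaller index to reach its own place. That place is free,
  -- because `c` as a member of `J` would be related to itself.
  fireAll-insert : ∀ {k} (e : Fin k → Event n) J c → (∀ b → b ∈ J → ¬ e c ∼ e b) → ∀ f →
                   fire (e c) (fireAll e J f) ⊑ fireAll e (J [ c ]≔ inside) f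
  fireAll-insert e (inside  ∷ J) zero    c≁ f x = contradiction (∼-refl (e zero)) (c≁ zero here)
  fireAll-insert e (outside ∷ J) zero    c≁ f x = ≤-refl
  fireAll-insert e (inside  ∷ J) (suc c) c≁ f x = ≤-trans
    (fire-comm (e (suc c)) (e zero) (c≁ zero here) _ x)
    (fire-mono (e zero) (fireAll-insert (e ∘ suc) J c (λ b b∈J → c≁ (suc b) (there b∈J)) f) x)
  fireAll-insert e (outside ∷ J) (suc c) c≁ f x =
    fireAll-insert (e ∘ suc) J c (λ b b∈J → c≁ (suc b) (there b∈J)) f x

  A : Subset m → (Config n → Carrier) → Config n → Carrier
  A = fireAll (event 𝓑)

  -- Neighbourhoods and stable sets

  N : Subset m → Fin m → Set
  N J c = ∃[ b ] b ∈ J × event 𝓑 c ∼ event 𝓑 b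

  N? : ∀ J c → Dec (N J c)
  N? J c = Fin.any? λ b → (b ∈? J) ×-dec (event 𝓑 c ∼? event 𝓑 b)

  ¬N⇒∉ : ∀ {J c} → ¬ N J c → c ∉ J
  ¬N⇒∉ {c = c} ¬N c∈J = ¬N (c , c∈J , ∼-refl (event 𝓑 c))

  -- When `K b` is `event 𝓑 b ∼ E`, this unfolds to the condition on `I` in the definition of `θ`.
  Stable : (Fin m → Set) → Subset m → Set
  Stable K J = (∀ b → b ∈ J → K b) × Independent 𝓑 J

  Stable-∅ : ∀ {K} → Stable K Subset.⊥
  Stable-∅ = (λ b b∈⊥ → contradiction b∈⊥ ∉⊥) , (λ b c b∈⊥ → contradiction b∈⊥ ∉⊥)

  Stable-⊆ : ∀ {K K′} → (∀ b → K b → K′ b) → ∀ {J} → Stable K J → Stable K′ J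
  Stable-⊆ K⊆K′ (J⊆K , indep) = (λ b b∈J → K⊆K′ b (J⊆K b b∈J)) , indep

  Stable-insert : ∀ {K J c} → K c → ¬ N J c → Stable K J → Stable K (J [ c ]≔ inside)
  Stable-insert {K} {J} {c} Kc ¬N (J⊆K , indep) = ⊆K , indep′
    where
    ⊆K : ∀ b → b ∈ J [ c ]≔ inside → K b
    ⊆K b b∈ with ∈-insert⁻ J c b∈
    ... | inj₁ ≡.refl = Kc
    ... | inj₂ b∈J    = J⊆K b b∈J
    indep′ : Independent 𝓑 (J [ c ]≔ inside)
    indep′ a b a∈ b∈ a≢b a∼b with ∈-insert⁻ J c a∈ | ∈-insert⁻ J c b∈
    ... | inj₁ ≡.refl | inj₁ ≡.refl = a≢b ≡.refl
    ... | inj₁ ≡.refl | inj₂ b∈J    = ¬N (b , b∈J , a∼b)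
    ... | inj₂ a∈J    | inj₁ ≡.refl = ¬N (a , a∈J , ∼-sym (event 𝓑 a) (event 𝓑 b) a∼b)
    ... | inj₂ a∈J    | inj₂ b∈J    = indep a b a∈J b∈J a≢b a∼b

  -- The sum of A I_d (⋯ (A I₁ f)) over all stable sequences I₁ ⊆ K, I₂ ⊆ N I₁, …, I_d ⊆ N I_{d−1}
  -- of independent sets; the last sets of a sequence may be empty.
  sequences : ℕ → (Fin m → Set) → (Config n → Carrier) → Config n → Carrier
  sequences ℕ.zero    K f x = f x
  sequences (ℕ.suc d) K f x = ∑ λ J → 𝟙 (Stable K J) * sequences d (N J) (A J f) x

  -- Prefixing a resampling to a stable sequence

  module _ (c : Fin m) where

    -- The part of `sequences` in which no set has a member related to c, and the rest, sorted by
    -- the last set that has one.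
    far near : ℕ → (Fin m → Set) → (Config n → Carrier) → Config n → Carrier
    far ℕ.zero    K f x = f x
    far (ℕ.suc d) K f x = ∑ λ J → 𝟙 (Stable K J × ¬ N J c) * far d (N J) (A J f) x

    -- `near-first` has the last set related to `c` in first position; `near-later` has it further
    -- on.
    near-later near-first : ℕ → (Fin m → Set) → (Config n → Carrier) → Config n → Carrier
    near ℕ.zero    K f x = 0#
    near (ℕ.suc d) K f x = near-later d K f x + near-first d K f x
    near-later d K f x = ∑ λ J → 𝟙 (Stable K J) * near d (N J) (A J f) x
    near-first d K f x = ∑ λ J → 𝟙 (Stable K J × N J c) * far d (N J) (A J f) x

    sequences-split : ∀ d K f x → sequences d K f x ≈ near d K f x + far d K f x
    sequences-split ℕ.zero    K f x = sym (+-identityˡ _)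
    sequences-split (ℕ.suc d) K f x = begin-equality
      ∑ (λ J → 𝟙 (Stable K J) * sequences d (N J) (A J f) x)
        ≈⟨ ∑-cong (λ J → trans (*-congˡ (sequences-split d (N J) (A J f) x)) (trans (distribˡ _ _ _)
             (+-congˡ (sym (𝟙-split (N? J c)))))) ⟩
      ∑ (λ J → 𝟙 (Stable K J) * near d (N J) (A J f) x
               + (𝟙 (Stable K J × N J c) * far d (N J) (A J f) x
                  + 𝟙 (Stable K J × ¬ N J c) * far d (N J) (A J f) x))
        ≈⟨ trans (∑-+ _ _) (+-congˡ (∑-+ _ _)) ⟩
      near-later d K f x + (near-first d K f x + far (ℕ.suc d) K f x)
        ≈⟨ +-assoc _ _ _ ⟨
      near (ℕ.suc d) K f x + far (ℕ.suc d) K f x ∎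

    far-mono : ∀ d {K K′ f g} → (∀ b → K b → K′ b) → f ⊑ g → far d K f ⊑ far d K′ g
    far-mono ℕ.zero    K⊆K′ f⊑g x = f⊑g x
    far-mono (ℕ.suc d) K⊆K′ f⊑g x = ∑-mono λ J → 𝟙-elim λ (stable , ¬N) → ≤-trans
      (far-mono d (λ _ N → N) (fireAll-mono (event 𝓑) J f⊑g) x)
      (𝟙-intro (Stable-⊆ K⊆K′ stable , ¬N))

    -- The base case appends the empty set, which has no member related to `c` and contributes the
    -- identity operator.
    far-suc : ∀ d K f → far d K f ⊑ far (ℕ.suc d) K f
    far-suc ℕ.zero    K f x = begin
      f x
        ≡⟨ ≡.cong (λ h → h x) (fireAll-∅ (event 𝓑) f) ⟨
      A Subset.⊥ f x
        ≤⟨ 𝟙-intro (Stable-∅ , λ (_ , b∈⊥ , _) → ∉⊥ b∈⊥) ⟩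
      𝟙 (Stable K Subset.⊥ × ¬ N Subset.⊥ c) * A Subset.⊥ f x
        ≤⟨ ∑-point (λ J → 𝟙 (Stable K J × ¬ N J c) * A J f x) Subset.⊥ ⟩
      far 1 K f x ∎
    far-suc (ℕ.suc d) K f x = ∑-mono λ J → *-monoʳ (far-suc d (N J) (A J f) x)

    far-base : ∀ d K f → f ⊑ far d K f
    far-base ℕ.zero    K f x = ≤-refl
    far-base (ℕ.suc d) K f x = ≤-trans (far-base d K f x) (far-suc d K f x)

    -- `c` is unrelated to every member of every set, so its operator commutes past them all and
    -- acts on `f` directly.
    fire-far : ∀ d K f → fire (event 𝓑 c) (far d K f) ⊑ far d K (fire (event 𝓑 c) f)
    fire-far ℕ.zero    K f x = ≤-refl
    fire-far (ℕ.suc d) K f x = ≤-trans (fire-∑ (event 𝓑 c) _ _ x) (∑-mono λ J → 𝟙-map λ (_ , ¬N) →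
      ≤-trans (fire-far d (N J) (A J f) x)
        (far-mono d (λ _ N → N)
          (fireAll-comm (event 𝓑) J (event 𝓑 c) (λ b b∈J c∼b → ¬N (b , b∈J , c∼b)) f) x))

    -- A resampling of c that precedes a sequence far from it can be moved into its first set.
    fire-far-first : ∀ d K f → K c → fire (event 𝓑 c) (far d K f) ⊑ near-first d K f
    -- The appended empty set provides a first set to receive `c` even when `d` is zero.
    fire-far-first d K f Kc x = ≤-trans (fire-mono (event 𝓑 c) (far-suc d K f) x) (begin
      fire (event 𝓑 c) (far (ℕ.suc d) K f) x
        ≤⟨ fire-∑ (event 𝓑 c) _ _ x ⟩
      ∑ (λ J → 𝟙 (Stable K J × ¬ N J c) * fire (event 𝓑 c) (far d (N J) (A J f)) x)
        -- As `c` is related to itself, it is not in `J`; deleting it recovers `J`, so distinct sets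
        -- stay distinct after the insertion.
        ≤⟨ ∑-reindex (λ J → ¬? (N? J c)) (_[ c ]≔ inside)
             (λ ¬NI ¬NJ → insert-injective (¬N⇒∉ ¬NI) (¬N⇒∉ ¬NJ))
             (λ J ¬¬N → 𝟙-false λ (_ , ¬N) → ¬¬N ¬N)
             (λ J ¬N → 𝟙-elim λ (stable , _) → ≤-trans (moved J ¬N)
               (𝟙-intro (Stable-insert Kc ¬N stable , c , ∈-insert J c , ∼-refl (event 𝓑 c)))) ⟩
      near-first d K f x ∎)
      where
      moved : ∀ J → ¬ N J c → let J′ = J [ c ]≔ inside in
              fire (event 𝓑 c) (far d (N J) (A J f)) x ≤ far d (N J′) (A J′ f) x
      -- The operator first passes the later sets and then joins `J`; enlarging `J` only enlarges
      -- the neighbourhood from which the next set is drawn.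
      moved J ¬N = ≤-trans (fire-far d (N J) (A J f) x)
        (far-mono d (λ { _ (b , b∈J , rel) → b , ∈-insert⁺ J c b∈J , rel })
          (fireAll-insert (event 𝓑) J c (λ b b∈J c∼b → ¬N (b , b∈J , c∼b)) f) x)

    -- `c` joins the set right after the last one related to it. Being related to that set is what
    -- admits `c` to the next one, and the rest of the sequence is far from `c`, so `fire-far-first`
    -- applies to it.
    fire-near : ∀ d K f → fire (event 𝓑 c) (near d K f) ⊑ near-later d K f
    fire-near ℕ.zero    K f x = fire-0 (event 𝓑 c) x
    fire-near (ℕ.suc d) K f x = begin
      fire (event 𝓑 c) (near (ℕ.suc d) K f) x
        ≤⟨ fire-+ (event 𝓑 c) _ _ x ⟩
      fire (event 𝓑 c) (near-later d K f) x + fire (event 𝓑 c) (near-first d K f) x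
        ≤⟨ +-mono (fire-∑ (event 𝓑 c) _ _ x) (fire-∑ (event 𝓑 c) _ _ x) ⟩
      ∑ (λ J → 𝟙 (Stable K J) * fire (event 𝓑 c) (near d (N J) (A J f)) x)
        + ∑ (λ J → 𝟙 (Stable K J × N J c) * fire (event 𝓑 c) (far d (N J) (A J f)) x)
        ≈⟨ ∑-+ _ _ ⟨
      ∑ (λ J → 𝟙 (Stable K J) * fire (event 𝓑 c) (near d (N J) (A J f)) x
               + 𝟙 (Stable K J × N J c) * fire (event 𝓑 c) (far d (N J) (A J f)) x)
        ≤⟨ ∑-mono (λ J → ≤-trans (+-mono ≤-refl 𝟙-×) (≤-trans (≥-reflexive (distribˡ _ _ _))
             (*-monoʳ (+-mono (fire-near d (N J) (A J f) x)
                              (𝟙-elim λ c∼J → fire-far-first d (N J) (A J f) c∼J x))))) ⟩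
      near-later (ℕ.suc d) K f x ∎

  -- Dominates the expected number of the next d steps that resample b and make E true.
  potential : Event n → Fin m → ℕ → Config n → Carrier
  potential E b d =
    sequences d (λ c → event 𝓑 c ∼ event 𝓑 b ⊎ event 𝓑 c ∼ E) (fire (event 𝓑 b) ⟪ E ⟫)

  -- Near sequences go to `near-later`, which leaves `near-first` and `far` for the far sequences
  -- and the reward for resampling `b` now. If `c` is related to `b` or `E`, the far sequences take
  -- `c` into their first set and the reward occupies the sequence of empty sets. Otherwise `c`
  -- differs from `b`, so there is no reward, and `c` moves through to `f` and is dropped.
  potential-step : ∀ E b c d x →
    fire (event 𝓑 c) (λ y → 𝟙 (y ⊨ E × c ≡ b) + potential E b d y) x ≤ potential E b (ℕ.suc d) x
  potential-step E b c d x = begin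
    fire C (λ y → 𝟙 (y ⊨ E × c ≡ b) + potential E b d y) x
      ≤⟨ ≤-trans (fire-+ C _ _ x) (+-mono reward
           (fire-mono C (λ y → ≤-reflexive (sequences-split c d K f y)) x)) ⟩
    𝟙 (c ≡ b) * f x + fire C (λ y → near c d K f y + far c d K f y) x
      ≤⟨ +-mono ≤-refl (≤-trans (fire-+ C _ _ x) (+-mono (fire-near c d K f x) ≤-refl)) ⟩
    𝟙 (c ≡ b) * f x + (near-later c d K f x + fire C (far c d K f) x)
      ≈⟨ +-Shuffle.x∙yz≈y∙zx _ _ _ ⟩
    near-later c d K f x + (fire C (far c d K f) x + 𝟙 (c ≡ b) * f x)
      ≤⟨ +-mono ≤-refl placed ⟩
    near-later c d K f x + (near-first c d K f x + far c (ℕ.suc d) K f x)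
      ≈⟨ trans (sym (+-assoc _ _ _)) (sym (sequences-split c (ℕ.suc d) K f x)) ⟩
    potential E b (ℕ.suc d) x ∎
    where
    C = event 𝓑 c
    K : Fin m → Set
    K a = event 𝓑 a ∼ event 𝓑 b ⊎ event 𝓑 a ∼ E
    f = fire (event 𝓑 b) ⟪ E ⟫

    reward : fire C (λ y → 𝟙 (y ⊨ E × c ≡ b)) x ≤ 𝟙 (c ≡ b) * f x
    reward = ≤-trans
      (fire-mono C (λ y → 𝟙-least λ (y⊨E , c≡b) → ≤-trans (𝟙-true y⊨E) (𝟙-intro c≡b)) x)
      (≤-trans (≤-reflexive (fire-*ˡ C (𝟙 (c ≡ b)) ⟪ E ⟫ x)) (𝟙-map λ { ≡.refl → ≤-refl }))

    placed : fire C (far c d K f) x + 𝟙 (c ≡ b) * f x ≤ near-first c d K f x + far c (ℕ.suc d) K f x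
    placed with (C ∼? event 𝓑 b) ⊎-dec (C ∼? E)
    ... | yes Kc = +-mono (fire-far-first c d K f Kc x) (𝟙-elim λ _ → far-base c (ℕ.suc d) K f x)
    ... | no ¬Kc = begin
      fire C (far c d K f) x + 𝟙 (c ≡ b) * f x
        ≤⟨ +-mono ≤-refl (𝟙-false λ { ≡.refl → ¬Kc (inj₁ (∼-refl C)) }) ⟩
      fire C (far c d K f) x + 0#
        ≈⟨ +-identityʳ _ ⟩
      fire C (far c d K f) x
        ≤⟨ fire-far c d K f x ⟩
      far c d K (fire C f) x
        ≤⟨ far-mono c d (λ _ k → k) (λ y → ≤-trans (fire-comm C (event 𝓑 b) (¬Kc ∘ inj₁) ⟪ E ⟫ y)
             (fire-mono (event 𝓑 b) (fire-⟪⟫ C E (¬Kc ∘ inj₂)) y)) x ⟩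
      far c d K f x
        ≤⟨ far-suc c d K f x ⟩
      far c (ℕ.suc d) K f x
        ≤⟨ y≤x+y ⟩
      near-first c d K f x + far c (ℕ.suc d) K f x ∎

-- Expectations and runs

module Expectation (R : SummableSemiring) {n m : ℕ}
                   (ω : Redraw.Marginals R n) (𝓑 : BadEvents n m) where
  open Layers R ω 𝓑 public

  pmf : Config n → Carrier
  pmf x = ∏ λ i → proj₁ (ω i) (lookup x i)

  𝔼 : (Config n → Carrier) → Carrier
  𝔼 f = ∑ λ x → pmf x * f x

  PΩ : Event n → Carrier
  PΩ E = 𝔼 ⟪ E ⟫

  𝔼≈redraw-⊤ : ∀ f x → 𝔼 f ≈ redraw ω ⊤ f x
  𝔼≈redraw-⊤ f x = ∑-cong λ y → *-congʳ (∏-cong λ i → lookup-⊤ i y)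
    where
    lookup-⊤ : ∀ i y → proj₁ (ω i) (lookup y i) ≈
      (if lookup ⊤ i then proj₁ (ω i) (lookup y i) else 𝟙 (lookup y i ≡ lookup x i))
    lookup-⊤ i y rewrite Vec.lookup-replicate i inside = refl

  𝔼-∑ : (k : Subset m → Carrier) (f : Subset m → Config n → Carrier) →
        𝔼 (λ x → ∑ λ J → k J * f J x) ≈ ∑ λ J → k J * 𝔼 (f J)
  𝔼-∑ k f = begin-equality
    ∑ (λ x → pmf x * ∑ λ J → k J * f J x)
      ≈⟨ ∑-cong (λ x → trans (*-distribˡ-∑ _ _) (∑-cong λ J → *-Shuffle.x∙yz≈y∙xz _ _ _)) ⟩
    ∑ (λ x → ∑ λ J → k J * (pmf x * f J x))
      ≈⟨ ∑-swap _≟ᶜ_ _≟ˢ_ _ ⟩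
    ∑ (λ J → ∑ λ x → k J * (pmf x * f J x))
      ≈⟨ ∑-cong (λ J → *-distribˡ-∑ _ _) ⟨
    ∑ (λ J → k J * 𝔼 (f J)) ∎

  -- fire E f depends on the variables of E only through ⟪ E ⟫, hence the independence.
  𝔼-fire : ∀ E f → 𝔼 (fire E f) ≈ PΩ E * 𝔼 f
  𝔼-fire E f = begin-equality
    𝔼 (fire E f)                                 ≈⟨ 𝔼≈redraw-⊤ (fire E f) x ⟩
    redraw ω ⊤ (fire E f) x                      ≈⟨ redraw-independent ω (vars E) (⟪⟫-local E) f x ⟩
    redraw ω ⊤ ⟪ E ⟫ x * redraw ω ⊤ f x          ≈⟨ *-cong (𝔼≈redraw-⊤ ⟪ E ⟫ x) (𝔼≈redraw-⊤ f x) ⟨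
    PΩ E * 𝔼 f                                   ∎
    where x = replicate n 0ℤ

  -- Products over sets and the independence polynomial

  factor : ∀ {k} → (Fin k → Carrier) → Subset k → Fin k → Carrier
  factor w J b = if lookup J b then w b else 1#

  over : ∀ {k} → (Fin k → Carrier) → Subset k → Carrier
  over w J = ∏ λ b → factor w J b

  𝔼-fireAll : ∀ {k} (e : Fin k → Event n) J f → 𝔼 (fireAll e J f) ≈ over (PΩ ∘ e) J * 𝔼 f
  𝔼-fireAll e []            f = sym (*-identityˡ _)
  𝔼-fireAll e (inside  ∷ J) f = trans (𝔼-fire (e zero) _)
    (trans (*-congˡ (𝔼-fireAll (e ∘ suc) J f)) (sym (*-assoc _ _ _)))
  𝔼-fireAll e (outside ∷ J) f = trans (𝔼-fireAll (e ∘ suc) J f) (*-congʳ (sym (*-identityˡ _)))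

  over-mono : ∀ {k} {v w : Fin k → Carrier} → (∀ b → v b ≤ w b) → ∀ J → over v J ≤ over w J
  over-mono {v = v} {w} v≤w J = ∏-mono pointwise
    where
    pointwise : ∀ b → factor v J b ≤ factor w J b
    pointwise b with lookup J b
    ... | true  = v≤w b
    ... | false = ≤-refl

  over-* : ∀ {k} (v w : Fin k → Carrier) J → over v J * over w J ≈ over (λ b → v b * w b) J
  over-* v w J = trans (sym (∏-* (factor v J) (factor w J))) (∏-cong pointwise)
    where
    pointwise : ∀ b → factor v J b * factor w J b ≈ factor (λ b → v b * w b) J b
    pointwise b with lookup J b
    ... | true  = refl
    ... | false = *-identityˡ 1#

  over-∅ : ∀ {k} (w : Fin k → Carrier) → over w Subset.⊥ ≈ 1#
  over-∅ {ℕ.zero}  w = refl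
  over-∅ {ℕ.suc k} w = trans (*-identityˡ _) (over-∅ (w ∘ suc))

  over-partition : ∀ {k} (w : Fin k → Carrier) I S → over w I ≈ over w (I ∩ S) * over w (I ∩ ∁ S)
  over-partition w I S =
    trans (∏-cong pointwise) (∏-* (factor w (I ∩ S)) (factor w (I ∩ ∁ S)))
    where
    pointwise : ∀ b → factor w I b ≈ factor w (I ∩ S) b * factor w (I ∩ ∁ S) b
    pointwise b rewrite Vec.lookup-zipWith _∧_ b I S | Vec.lookup-zipWith _∧_ b I (∁ S)
                      | Vec.lookup-map b not S with lookup I b | lookup S b
    ... | true  | true  = sym (*-identityʳ _)
    ... | true  | false = sym (*-identityˡ _)
    ... | false | _     = sym (*-identityˡ _)

  module Weights (μ : Fin m → Carrier) where

    -- The independence polynomial of the dependency graph restricted to `K`, evaluated at `μ`.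
    M : (Fin m → Set) → Carrier
    M K = ∑ λ I → 𝟙 (Stable K I) * over μ I

    M-mono : ∀ {K K′} → (∀ b → K b → K′ b) → M K ≤ M K′
    M-mono K⊆K′ = ∑-mono λ I → 𝟙-elim λ stable → 𝟙-intro (Stable-⊆ K⊆K′ stable)

    1≤M : ∀ {K} → 1# ≤ M K
    1≤M {K} = begin
      1#
        ≈⟨ over-∅ μ ⟨
      over μ Subset.⊥
        ≤⟨ 𝟙-intro (Stable-∅ {K}) ⟩
      𝟙 (Stable K Subset.⊥) * over μ Subset.⊥
        ≤⟨ ∑-point (λ I → 𝟙 (Stable K I) * over μ I) Subset.⊥ ⟩
      M K ∎

    M-empty : ∀ {K} → (∀ b → ¬ K b) → M K ≤ 1#
    M-empty {K} empty = begin
      M K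
        ≤⟨ ∑-mono (λ I → 𝟙-elim λ (I⊆K , _) →
             𝟙-intro (Empty-unique λ (b , b∈I) → empty b (I⊆K b b∈I))) ⟩
      ∑ (λ I → 𝟙 (I ≡ Subset.⊥) * over μ I)
        ≈⟨ ∑-𝟙≡ _≟ˢ_ Subset.⊥ (over μ) ⟩
      over μ Subset.⊥
        ≈⟨ over-∅ μ ⟩
      1# ∎

    -- An independent set splits injectively into its part in `K` and the remainder, which lies in
    -- `K′`. Decidability of `K` makes the two parts subsets.
    M-⊎ : ∀ {K K′} → Unary.Decidable K → M (λ b → K b ⊎ K′ b) ≤ M K * M K′
    M-⊎ {K} {K′} K? = begin
      M (λ b → K b ⊎ K′ b)
        ≤⟨ ∑-mono (λ I → 𝟙-elim λ stable → ≤-trans (≤-reflexive (over-partition μ I ⟦ K? ⟧))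
             (*-mono (𝟙-intro (left I stable)) (𝟙-intro (right I stable)))) ⟩
      ∑ (λ I → h (parts I))
        ≤⟨ ∑-injection parts parts-injective h ⟩
      ∑ h
        ≤⟨ ∑-×≤∑∑ _≟ˢ_ _≟ˢ_ h ⟩
      ∑ (λ I₁ → ∑ λ I₂ → h (I₁ , I₂))
        ≈⟨ trans (∑-cong λ I₁ → sym (*-distribˡ-∑ _ _)) (sym (*-distribʳ-∑ _ _)) ⟩
      M K * M K′ ∎
      where
      h : Subset m × Subset m → Carrier
      h (I₁ , I₂) = (𝟙 (Stable K I₁) * over μ I₁) * (𝟙 (Stable K′ I₂) * over μ I₂)
      parts : Subset m → Subset m × Subset m
      parts I = I ∩ ⟦ K? ⟧ , I ∩ ∁ ⟦ K? ⟧
      parts-injective : ∀ {I J} → parts I ≡ parts J → I ≡ J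
      parts-injective {I} {J} eq = ≡.trans (≡.sym (partition-∩ I ⟦ K? ⟧))
        (≡.trans (≡.cong (λ (p , q) → p ∪ q) eq) (partition-∩ J ⟦ K? ⟧))
      independent-∩ : ∀ I S → Independent 𝓑 I → Independent 𝓑 (I ∩ S)
      independent-∩ I S indep a b a∈ b∈ =
        indep a b (proj₁ (x∈p∩q⁻ I S a∈)) (proj₁ (x∈p∩q⁻ I S b∈))
      left : ∀ I → Stable (λ b → K b ⊎ K′ b) I → Stable K (I ∩ ⟦ K? ⟧)
      left I (_ , indep) =
        (λ b b∈ → ∈⟦⟧⁻ K? (proj₂ (x∈p∩q⁻ I ⟦ K? ⟧ b∈))) , independent-∩ I _ indep
      right : ∀ I → Stable (λ b → K b ⊎ K′ b) I → Stable K′ (I ∩ ∁ ⟦ K? ⟧)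
      right I (I⊆ , indep) = ⊆K′ , independent-∩ I _ indep
        where
        ⊆K′ : ∀ b → b ∈ I ∩ ∁ ⟦ K? ⟧ → K′ b
        ⊆K′ b b∈ with x∈p∩q⁻ I (∁ ⟦ K? ⟧) b∈
        ... | b∈I , b∉K with I⊆ b b∈I
        ...   | inj₁ Kb  = contradiction (∈⟦⟧⁺ K? Kb) (x∈∁p⇒x∉p b∉K)
        ...   | inj₂ K′b = K′b

    -- Applied to `N J`, this charges the later sets to the members of `J` one by one, so that each
    -- factor can meet the probability of its member and form a `θ`.
    M-⋃ : ∀ {k} (K : Fin k → Fin m → Set) → (∀ b → Unary.Decidable (K b)) → ∀ J →
          M (λ c → ∃[ b ] b ∈ J × K b c) ≤ over (λ b → M (K b)) J
    M-⋃ K K? []            = M-empty λ { _ (() , _) }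
    M-⋃ K K? (inside  ∷ J) = ≤-trans
      (M-mono λ { _ (zero , _ , Kb) → inj₁ Kb ; _ (suc b , there b∈J , Kb) → inj₂ (b , b∈J , Kb) })
      (≤-trans (M-⊎ (K? zero)) (*-monoʳ (M-⋃ (K ∘ suc) (K? ∘ suc) J)))
    M-⋃ K K? (outside ∷ J) = ≤-trans
      (M-mono λ { _ (suc b , there b∈J , Kb) → b , b∈J , Kb })
      (≤-trans (M-⋃ (K ∘ suc) (K? ∘ suc) J) (≥-reflexive (*-identityˡ _)))

    θ : Event n → Carrier
    θ E = PΩ E * M (λ b → event 𝓑 b ∼ E)

    module _ (θ≤μ : ∀ b → θ (event 𝓑 b) ≤ μ b) where

      -- Once the first set `J` is peeled off, the later sets cost at most `M (N J)` and the members
      -- of `J` contribute their probabilities. Regrouped by member this is a product of values of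
      -- `θ`, hence at most `over μ J`, and summing over `J` restores `M K`. The function `f` varies
      -- because it becomes `A J f`.
      𝔼-sequences : ∀ d K f → 𝔼 (sequences d K f) ≤ M K * 𝔼 f
      𝔼-sequences ℕ.zero    K f = ≤-trans (≥-reflexive (*-identityˡ _)) (*-mono 1≤M ≤-refl)
      𝔼-sequences (ℕ.suc d) K f = begin
        𝔼 (sequences (ℕ.suc d) K f)
          ≈⟨ 𝔼-∑ _ _ ⟩
        ∑ (λ J → 𝟙 (Stable K J) * 𝔼 (sequences d (N J) (A J f)))
          ≤⟨ ∑-mono (λ J → *-monoʳ (≤-trans (𝔼-sequences d (N J) (A J f)) (bound J))) ⟩
        ∑ (λ J → 𝟙 (Stable K J) * (over μ J * 𝔼 f))
          ≈⟨ trans (∑-cong λ J → sym (*-assoc _ _ _)) (sym (*-distribʳ-∑ _ _)) ⟩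
        M K * 𝔼 f ∎
        where
        p q : Fin m → Carrier
        p b = PΩ (event 𝓑 b)
        q b = M (λ c → event 𝓑 c ∼ event 𝓑 b)
        bound : ∀ J → M (N J) * 𝔼 (A J f) ≤ over μ J * 𝔼 f
        bound J = begin
          M (N J) * 𝔼 (A J f)
            ≤⟨ *-mono (M-⋃ _ (λ b c → event 𝓑 c ∼? event 𝓑 b) J)
                       (≤-reflexive (𝔼-fireAll (event 𝓑) J f)) ⟩
          over q J * (over p J * 𝔼 f)
            ≈⟨ *-Shuffle.x∙yz≈yx∙z _ _ _ ⟩
          over p J * over q J * 𝔼 f
            ≈⟨ *-congʳ (over-* p q J) ⟩
          over (λ b → θ (event 𝓑 b)) J * 𝔼 f
            ≤⟨ *-mono (over-mono θ≤μ J) ≤-refl ⟩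
          over μ J * 𝔼 f ∎

      𝔼-potential : ∀ E b d → 𝔼 (potential E b d) ≤ μ b * θ E
      𝔼-potential E b d = begin
        𝔼 (potential E b d)
          ≤⟨ 𝔼-sequences d _ _ ⟩
        M (λ c → event 𝓑 c ∼ event 𝓑 b ⊎ event 𝓑 c ∼ E) * 𝔼 (fire (event 𝓑 b) ⟪ E ⟫)
          ≤⟨ *-mono (M-⊎ (λ c → event 𝓑 c ∼? event 𝓑 b)) (≤-reflexive (𝔼-fire (event 𝓑 b) ⟪ E ⟫)) ⟩
        (M (λ c → event 𝓑 c ∼ event 𝓑 b) * M (λ c → event 𝓑 c ∼ E)) * (PΩ (event 𝓑 b) * PΩ E)
          ≈⟨ trans (*-Shuffle.interchange _ _ _ _) (*-cong (*-comm _ _) (*-comm _ _)) ⟩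
        θ (event 𝓑 b) * θ E
          ≤⟨ *-mono (θ≤μ b) ≤-refl ⟩
        μ b * θ E ∎

  -- Weighted runs and the potential argument

  extend-injective : ∀ {t} {r r′ : Run n m t} {b b′ x x′} →
                     extend r b x ≡ extend r′ b′ x′ → (r , b , x) ≡ (r′ , b′ , x′)
  extend-injective ≡.refl = ≡.refl

  previous : ∀ {t} → Run n m (ℕ.suc t) → Run n m t × Fin m × Config n
  previous (extend r b x) = r , b , x

  previous-injective : ∀ {t} {r r′ : Run n m (ℕ.suc t)} → previous r ≡ previous r′ → r ≡ r′
  previous-injective {r = extend _ _ _} {extend _ _ _} ≡.refl = ≡.refl

  _≟ʳ_ : ∀ {t} → DecidableEquality (Run n m t)
  start x      ≟ʳ start y       = map′ (≡.cong start) (λ { ≡.refl → ≡.refl }) (x ≟ᶜ y)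
  extend r b x ≟ʳ extend s c y  = map′ (λ { ≡.refl → ≡.refl }) extend-injective
    (Product.≡-dec _≟ʳ_ (Product.≡-dec Fin._≟_ _≟ᶜ_) (r , b , x) (s , c , y))

  -- Executions enter through upper bounds. The total choice is at most one, which also covers
  -- terminated runs, where every choice is zero.
  record Process : Set₁ where
    field
      weight   : ∀ {t} → Run n m t → Carrier
      choice   : ∀ {t} → Run n m t → Fin m → Carrier
      initial  : ∀ x → weight (start x) ≤ pmf x
      step     : ∀ {t} (r : Run n m t) c y →
                 weight (extend r c y) ≤
                 weight r * choice r c * kernel ω (vars (event 𝓑 c)) (current r) y
      choose-true : ∀ {t} (r : Run n m t) c → ¬ current r ⊨ event 𝓑 c → choice r c ≤ 0#
      choose-one  : ∀ {t} (r : Run n m t) → ∑ (choice r) ≤ 1#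

  module _ (process : Process) where
    open Process process

    ∑-extend : ∀ {t} (h : Run n m (ℕ.suc t) → Carrier) →
               ∑ h ≤ ∑ λ r → ∑ λ c → ∑ λ y → h (extend r c y)
    ∑-extend h = begin
      ∑ h
        ≤⟨ ∑-mono (λ { (extend r b x) → ≤-refl }) ⟩
      ∑ (λ r → h′ (previous r))
        ≤⟨ ∑-injection previous previous-injective h′ ⟩
      ∑ h′
        ≤⟨ ∑-×≤∑∑ (Product.≡-dec Fin._≟_ _≟ᶜ_) _≟ʳ_ h′ ⟩
      ∑ (λ r → ∑ λ cy → h′ (r , cy))
        ≤⟨ ∑-mono (λ r → ∑-×≤∑∑ _≟ᶜ_ Fin._≟_ _) ⟩
      ∑ (λ r → ∑ λ c → ∑ λ y → h (extend r c y)) ∎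
      where
      h′ : Run n m _ × Fin m × Config n → Carrier
      h′ (r , c , y) = h (extend r c y)

    module _ (E : Event n) (b : Fin m) where

      private
        Success : ∀ {t} → Run n m (ℕ.suc t) → Set
        Success r = current r ⊨ E × resampled r ≡ b

      -- `count t` concerns resampling number `t + 1`, while `expected t d` is to pay for the `d`
      -- resamplings after the `t`-th.
      count : ℕ → Carrier
      count t = ∑ λ (r : Run n m (ℕ.suc t)) → weight r * 𝟙 (Success r)

      expected : ℕ → ℕ → Carrier
      expected t d = ∑ λ (r : Run n m t) → weight r * potential E b d (current r)

      -- If `c` is true, its indicator can be inserted and the redraw becomes `fire`, so
      -- `potential-step` applies; otherwise `choice r c` is zero.
      choice-step : ∀ {t} d (r : Run n m t) c →
        ∑ (λ y → weight (extend r c y) * (𝟙 (y ⊨ E × c ≡ b) + potential E b d y)) ≤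
        weight r * (choice r c * potential E b (ℕ.suc d) (current r))
      choice-step d r c = begin
        ∑ (λ y → weight (extend r c y) * g y)
          ≤⟨ ∑-mono (λ y → ≤-trans (*-mono (step r c y) ≤-refl) (≤-reflexive (*-assoc _ _ _))) ⟩
        ∑ (λ y → weight r * choice r c * (kernel ω (vars C) (current r) y * g y))
          ≈⟨ trans (sym (*-distribˡ-∑ _ _)) (*-assoc _ _ _) ⟩
        weight r * (choice r c * redraw ω (vars C) g (current r))
          ≤⟨ *-monoʳ chosen ⟩
        weight r * (choice r c * potential E b (ℕ.suc d) (current r)) ∎
        where
        C = event 𝓑 c
        g : Config n → Carrier
        g y = 𝟙 (y ⊨ E × c ≡ b) + potential E b d y
        chosen : choice r c * redraw ω (vars C) g (current r) ≤
                 choice r c * potential E b (ℕ.suc d) (current r)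
        chosen with T? (holds C (current r))
        ... | yes holds = *-monoʳ (≤-trans (𝟙-intro holds) (potential-step E b c d (current r)))
        ... | no ¬holds = ≤-trans (*-mono (choose-true r c ¬holds) ≤-refl)
                                 (≤-trans (≤-reflexive (zeroˡ _)) (0≤ _))

      -- A supermartingale inequality: the potential before a step pays for the reward and the
      -- potential after it. The bound is the same for every `c`, so averaging over the selection
      -- rule preserves it.
      count-step : ∀ t d → count t + expected (ℕ.suc t) d ≤ expected t (ℕ.suc d)
      count-step t d = begin
        count t + expected (ℕ.suc t) d
          ≤⟨ ∑-+-≥ _≟ʳ_ _ _ ⟩
        ∑ (λ r → weight r * 𝟙 (Success r) + weight r * potential E b d (current r))
          ≤⟨ ∑-mono (λ r → ≥-reflexive (distribˡ _ _ _)) ⟩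
        ∑ (λ r → weight r * (𝟙 (Success r) + potential E b d (current r)))
          ≤⟨ ∑-extend _ ⟩
        ∑ (λ r → ∑ λ c → ∑ λ y → weight (extend r c y) * (𝟙 (y ⊨ E × c ≡ b) + potential E b d y))
          ≤⟨ ∑-mono (λ r → ∑-mono λ c → choice-step d r c) ⟩
        ∑ (λ r → ∑ λ c → weight r * (choice r c * potential E b (ℕ.suc d) (current r)))
          ≤⟨ ∑-mono (λ r → ≤-trans
               (≥-reflexive (trans (*-congˡ (*-distribʳ-∑ _ _)) (*-distribˡ-∑ _ _)))
               (*-monoʳ (≤-trans (*-mono (choose-one r) ≤-refl) (≤-reflexive (*-identityˡ _))))) ⟩
        expected t (ℕ.suc d) ∎

      interval : ℕ → ℕ → List ℕ
      interval t ℕ.zero    = []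
      interval t (ℕ.suc d) = t ∷ interval (ℕ.suc t) d

      ∈-interval : ∀ {s} t d → t ℕ.≤ s → s ℕ.< t ℕ.+ d → s List.∈ interval t d
      ∈-interval {s} t ℕ.zero    t≤s s<t =
        contradiction (≡.subst (s ℕ.<_) (ℕ.+-identityʳ t) s<t) (ℕ.≤⇒≯ t≤s)
      ∈-interval {s} t (ℕ.suc d) t≤s s<t+d with t ℕ.≟ s
      ... | yes ≡.refl = here ≡.refl
      ... | no  t≢s    = there (∈-interval (ℕ.suc t) d (ℕ.≤∧≢⇒< t≤s t≢s)
                           (≡.subst (s ℕ.<_) (ℕ.+-suc t d) s<t+d))

      ⊆-interval : ∀ ts → ∃[ d ] (∀ {s} → s List.∈ ts → s List.∈ interval 0 d)
      -- The sum of the times bounds each of them; the successor is taken because the interval of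
      -- length `d` from 0 excludes `d` itself.
      ⊆-interval ts = ℕ.suc (sum ts) , λ s∈ts → ∈-interval 0 _ ℕ.z≤n (ℕ.s≤s (≤-sum ts s∈ts))
        where
        ≤-sum : ∀ ts {s} → s List.∈ ts → s ℕ.≤ sum ts
        ≤-sum (t ∷ ts) (here ≡.refl) = ℕ.m≤m+n t _
        ≤-sum (t ∷ ts) (there s∈ts)  = ℕ.≤-trans (≤-sum ts s∈ts) (ℕ.m≤n+m _ t)

      counts≤expected : ∀ t d → sumOver count (interval t d) ≤ expected t d
      counts≤expected t ℕ.zero    = 0≤ _
      counts≤expected t (ℕ.suc d) =
        ≤-trans (+-mono ≤-refl (counts≤expected (ℕ.suc t) d)) (count-step t d)

      initially : ∀ d → expected 0 d ≤ 𝔼 (potential E b d)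
      initially d = begin
        expected 0 d
          ≤⟨ ∑-mono (λ { (start x) → *-mono (initial x) ≤-refl }) ⟩
        ∑ (λ r → pmf (current r) * potential E b d (current r))
          ≤⟨ ∑-injection current (λ { {start _} {start _} ≡.refl → ≡.refl }) _ ⟩
        𝔼 (potential E b d) ∎

      -- The horizon `d` depends on the finite set of times considered, which is why the bound is
      -- asked for uniformly in `d`.
      ∑-count≤ : ∀ {y} → (∀ d → 𝔼 (potential E b d) ≤ y) → ∑ count ≤ y
      ∑-count≤ {y} bound = ∑-least λ ts ts! → let d , ts⊆ = ⊆-interval ts in begin
        sumOver count ts             ≤⟨ sumOver-⊆ count ts! ts⊆ ⟩
        sumOver count (interval 0 d) ≤⟨ counts≤expected 0 d ⟩
        expected 0 d                 ≤⟨ initially d ⟩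
        𝔼 (potential E b d)          ≤⟨ bound d ⟩
        y                            ∎

-- The extended non-negative reals

open import Defs

≤-refl : ∀ {x} → x ≤ x
≤-refl q q<x = q<x

≤-trans : ∀ {x y z} → x ≤ y → y ≤ z → x ≤ z
≤-trans x≤y y≤z q q<x = y≤z q (x≤y q q<x)

≈-isEquivalence : IsEquivalence _≈_
≈-isEquivalence = record
  { refl  = λ {x} → ≤-refl {x} , ≤-refl {x}
  ; sym   = λ (x≤y , y≤x) → y≤x , x≤y
  ; trans = λ {x} {y} {z} (x≤y , y≤x) (y≤z , z≤y) →
      ≤-trans {x} {y} {z} x≤y y≤z , ≤-trans {z} {y} {x} z≤y y≤x
  }

≤-isPartialOrder : IsPartialOrder _≈_ _≤_
≤-isPartialOrder = record
  { isPreorder = record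
    { isEquivalence = ≈-isEquivalence
    ; reflexive     = proj₁
    ; trans         = λ {x} {y} {z} → ≤-trans {x} {y} {z}
    }
  ; antisym = _,_
  }

0≤ : ∀ x → 0# ≤ x
0≤ x q q<0 = negative x q<0

+-mono : ∀ {x y u v} → x ≤ y → u ≤ v → x + u ≤ y + v
+-mono x≤y u≤v q (a , b , a<x , b<u , q≤a+b) = a , b , x≤y a a<x , u≤v b b<u , q≤a+b

+-comm-≤ : ∀ x y → x + y ≤ y + x
+-comm-≤ x y q (a , b , a<x , b<y , q≤a+b) =
  b , a , b<y , a<x , ℚ.≤-trans q≤a+b (ℚ.≤-reflexive (ℚ.+-comm a b))

+-assoc-≤ : ∀ x y z → (x + y) + z ≤ x + (y + z)
+-assoc-≤ x y z q (s , c , (a , b , a<x , b<y , s≤a+b) , c<z , q≤s+c) =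
  a , b ℚ.+ c , a<x , (b , c , b<y , c<z , ℚ.≤-refl) ,
  ℚ.≤-trans q≤s+c (ℚ.≤-trans (ℚ.+-monoˡ-≤ c s≤a+b) (ℚ.≤-reflexive (ℚ.+-assoc a b c)))

+-assoc-≥ : ∀ x y z → x + (y + z) ≤ (x + y) + z
+-assoc-≥ x y z q (a , s , a<x , (b , c , b<y , c<z , s≤b+c) , q≤a+s) =
  a ℚ.+ b , c , (a , b , a<x , b<y , ℚ.≤-refl) , c<z ,
  ℚ.≤-trans q≤a+s (ℚ.≤-trans (ℚ.+-monoʳ-≤ a s≤b+c) (ℚ.≤-reflexive (≡.sym (ℚ.+-assoc a b c))))

p≤q+p : ∀ {p q} → q ℚ.< 0ℚ → ∀ {r} → r ℚ.≤ q ℚ.+ p → r ℚ.≤ p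
p≤q+p {p} {q} q<0 r≤q+p =
  ℚ.≤-trans r≤q+p (ℚ.≤-trans (ℚ.+-monoˡ-≤ p (ℚ.<⇒≤ q<0)) (ℚ.≤-reflexive (ℚ.+-identityˡ p)))

+-identityˡ-≤ : ∀ x → 0# + x ≤ x
+-identityˡ-≤ x q (a , b , a<0 , b<x , q≤a+b) = downward x (p≤q+p a<0 q≤a+b) b<x

-- The cut of `x` is open, so `q` can be raised to some `r` in it; the deficit `q - r` is negative
-- and therefore lies below any `y`.
x≤y+x : ∀ x y → x ≤ y + x
x≤y+x x y q q<x = let r , q<r , r<x = rounded x q<x in
  q ℚ.- r , r
  , negative y (≡.subst (q ℚ.- r ℚ.<_) (ℚ.+-inverseʳ r) (ℚ.+-monoˡ-< (ℚ.- r) q<r))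
  , r<x
  , ℚ.≤-reflexive (≡.sym (≡.trans (ℚ.+-assoc q (ℚ.- r) r)
      (≡.trans (≡.cong (q ℚ.+_) (ℚ.+-inverseˡ r)) (ℚ.+-identityʳ q))))

x≤x+y : ∀ x y → x ≤ x + y
x≤x+y x y q q<x = +-comm-≤ y x q (x≤y+x x y q q<x)

*-mono : ∀ {x y u v} → x ≤ y → u ≤ v → x * u ≤ y * v
*-mono x≤y u≤v q (inj₁ q<0) = inj₁ q<0
*-mono x≤y u≤v q (inj₂ (a , b , 0≤a , 0≤b , a<x , b<u , q≤ab)) =
  inj₂ (a , b , 0≤a , 0≤b , x≤y a a<x , u≤v b b<u , q≤ab)

*-comm-≤ : ∀ x y → x * y ≤ y * x
*-comm-≤ x y q (inj₁ q<0) = inj₁ q<0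
*-comm-≤ x y q (inj₂ (a , b , 0≤a , 0≤b , a<x , b<y , q≤ab)) =
  inj₂ (b , a , 0≤b , 0≤a , b<y , a<x , ℚ.≤-trans q≤ab (ℚ.≤-reflexive (ℚ.*-comm a b)))

*-monoˡ-ℚ : ∀ {a b c} → 0ℚ ℚ.≤ c → a ℚ.≤ b → a ℚ.* c ℚ.≤ b ℚ.* c
*-monoˡ-ℚ {c = c} 0≤c a≤b = ℚ.*-monoʳ-≤-nonNeg c {{nonNegative 0≤c}} a≤b

*-monoʳ-ℚ : ∀ {a b c} → 0ℚ ℚ.≤ c → a ℚ.≤ b → c ℚ.* a ℚ.≤ c ℚ.* b
*-monoʳ-ℚ {c = c} 0≤c a≤b = ℚ.*-monoˡ-≤-nonNeg c {{nonNegative 0≤c}} a≤b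

0≤* : ∀ {a b} → 0ℚ ℚ.≤ a → 0ℚ ℚ.≤ b → 0ℚ ℚ.≤ a ℚ.* b
0≤* {a} {b} 0≤a 0≤b = ℚ.≤-trans (ℚ.≤-reflexive (≡.sym (ℚ.*-zeroˡ b))) (*-monoˡ-ℚ 0≤b 0≤a)

0≤+ : ∀ {a b} → 0ℚ ℚ.≤ a → 0ℚ ℚ.≤ b → 0ℚ ℚ.≤ a ℚ.+ b
0≤+ 0≤a 0≤b = ℚ.≤-trans (ℚ.≤-reflexive (≡.sym (ℚ.+-identityˡ 0ℚ))) (ℚ.+-mono-≤ 0≤a 0≤b)

≤⇒≯ : ∀ {p q} → p ℚ.≤ q → ¬ q ℚ.< p
≤⇒≯ p≤q q<p = ℚ.<-irrefl ≡.refl (ℚ.≤-<-trans p≤q q<p)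

*-assoc-≤ : ∀ x y z → (x * y) * z ≤ x * (y * z)
*-assoc-≤ x y z q (inj₁ q<0) = inj₁ q<0
*-assoc-≤ x y z q (inj₂ (s , c , 0≤s , 0≤c , inj₁ s<0 , c<z , q≤sc)) =
  contradiction s<0 (≤⇒≯ 0≤s)
*-assoc-≤ x y z q (inj₂
  (s , c , 0≤s , 0≤c , inj₂ (a , b , 0≤a , 0≤b , a<x , b<y , s≤ab) , c<z , q≤sc)) =
  inj₂ (a , b ℚ.* c , 0≤a , 0≤* 0≤b 0≤c , a<x , inj₂ (b , c , 0≤b , 0≤c , b<y , c<z , ℚ.≤-refl)
       , ℚ.≤-trans q≤sc (ℚ.≤-trans (*-monoˡ-ℚ 0≤c s≤ab) (ℚ.≤-reflexive (ℚ.*-assoc a b c))))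

*-assoc-≥ : ∀ x y z → x * (y * z) ≤ (x * y) * z
*-assoc-≥ x y z q (inj₁ q<0) = inj₁ q<0
*-assoc-≥ x y z q (inj₂ (a , s , 0≤a , 0≤s , a<x , inj₁ s<0 , q≤as)) =
  contradiction s<0 (≤⇒≯ 0≤s)
*-assoc-≥ x y z q (inj₂
  (a , s , 0≤a , 0≤s , a<x , inj₂ (b , c , 0≤b , 0≤c , b<y , c<z , s≤bc) , q≤as)) =
  inj₂ (a ℚ.* b , c , 0≤* 0≤a 0≤b , 0≤c , inj₂ (a , b , 0≤a , 0≤b , a<x , b<y , ℚ.≤-refl) , c<z
       , ℚ.≤-trans q≤as (ℚ.≤-trans (*-monoʳ-ℚ 0≤a s≤bc) (ℚ.≤-reflexive (≡.sym (ℚ.*-assoc a b c)))))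

a<1⇒q≤b : ∀ {a b q} → a ℚ.< 1ℚ → 0ℚ ℚ.≤ b → q ℚ.≤ a ℚ.* b → q ℚ.≤ b
a<1⇒q≤b {b = b} a<1 0≤b q≤ab =
  ℚ.≤-trans q≤ab (ℚ.≤-trans (*-monoˡ-ℚ 0≤b (ℚ.<⇒≤ a<1)) (ℚ.≤-reflexive (ℚ.*-identityˡ b)))

𝟙-elim : ∀ {P x y} → (P → x ≤ y) → 𝟙 P * x ≤ y
𝟙-elim {y = y} h q (inj₁ q<0) = negative y q<0
𝟙-elim h q (inj₂ (a , b , 0≤a , 0≤b , inj₁ a<0 , b<x , q≤ab)) = contradiction a<0 (≤⇒≯ 0≤a)
𝟙-elim {y = y} h q (inj₂ (a , b , 0≤a , 0≤b , inj₂ (p , a<1) , b<x , q≤ab)) =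
  downward y (a<1⇒q≤b a<1 0≤b q≤ab) (h p b b<x)

*-identityˡ-≤ : ∀ x → 1# * x ≤ x
*-identityˡ-≤ x q (inj₁ q<0) = negative x q<0
*-identityˡ-≤ x q (inj₂ (a , b , 0≤a , 0≤b , a<1 , b<x , q≤ab)) =
  downward x (a<1⇒q≤b a<1 0≤b q≤ab) b<x

-- For non-negative `q`, openness gives some `r` above `q` and below `x`; then `q` is the product of
-- `q / r`, which is below one, and `r`.
*-identityˡ-≥ : ∀ x → x ≤ 1# * x
*-identityˡ-≥ x q q<x with q ℚ.<? 0ℚ
... | yes q<0 = inj₁ q<0
... | no  q≮0 = let
    r , q<r , r<x = rounded x q<x
    0≤q = ℚ.≮⇒≥ q≮0
    r>0 = ℚ.≤-<-trans 0≤q q<r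
    instance
      r⁺ = positive r>0
      r≢0 = ℚ.pos⇒nonZero r
      1/r⁺ = ℚ.1/pos⇒pos r
    0≤1/r = ℚ.<⇒≤ (ℚ.positive⁻¹ (1/ r))
  in inj₂ (q ℚ.* 1/ r , r , 0≤* 0≤q 0≤1/r , ℚ.<⇒≤ r>0
          , ≡.subst (q ℚ.* 1/ r ℚ.<_) (ℚ.*-inverseʳ r) (ℚ.*-monoˡ-<-pos (1/ r) q<r)
          , r<x
          , ℚ.≤-reflexive (≡.sym (≡.trans (ℚ.*-assoc q (1/ r) r)
              (≡.trans (≡.cong (q ℚ.*_) (ℚ.*-inverseˡ r)) (ℚ.*-identityʳ q)))))

*-zeroˡ-≤ : ∀ x → 0# * x ≤ 0#
*-zeroˡ-≤ x q (inj₁ q<0) = q<0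
*-zeroˡ-≤ x q (inj₂ (a , b , 0≤a , 0≤b , a<0 , b<x , q≤ab)) = contradiction a<0 (≤⇒≯ 0≤a)

-- A decomposition of `s` may use a negative part, which products do not admit. Such a part is
-- dropped, and the other part alone is at least `s`.
distribʳ-≤ : ∀ x y z → (y + z) * x ≤ y * x + z * x
distribʳ-≤ x y z q (inj₁ q<0) = negative (y * x + z * x) q<0
distribʳ-≤ x y z q (inj₂ (s , b , 0≤s , 0≤b , (a , c , a<y , c<z , s≤a+c) , b<x , q≤sb))
  with a ℚ.<? 0ℚ | c ℚ.<? 0ℚ
... | yes a<0 | _ = let s≤c = p≤q+p a<0 s≤a+c in
  x≤y+x (z * x) (y * x) q
    (inj₂ (c , b , ℚ.≤-trans 0≤s s≤c , 0≤b , c<z , b<x , ℚ.≤-trans q≤sb (*-monoˡ-ℚ 0≤b s≤c)))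
... | no a≮0 | yes c<0 = let s≤a = p≤q+p c<0 (ℚ.≤-trans s≤a+c (ℚ.≤-reflexive (ℚ.+-comm a c))) in
  x≤x+y (y * x) (z * x) q
    (inj₂ (a , b , ℚ.≤-trans 0≤s s≤a , 0≤b , a<y , b<x , ℚ.≤-trans q≤sb (*-monoˡ-ℚ 0≤b s≤a)))
... | no a≮0 | no c≮0 =
  a ℚ.* b , c ℚ.* b
  , inj₂ (a , b , ℚ.≮⇒≥ a≮0 , 0≤b , a<y , b<x , ℚ.≤-refl)
  , inj₂ (c , b , ℚ.≮⇒≥ c≮0 , 0≤b , c<z , b<x , ℚ.≤-refl)
  , ℚ.≤-trans q≤sb (ℚ.≤-trans (*-monoˡ-ℚ 0≤b s≤a+c) (ℚ.≤-reflexive (ℚ.*-distribʳ-+ b a c)))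

distribʳ-≥ : ∀ x y z → y * x + z * x ≤ (y + z) * x
distribʳ-≥ x y z q (q₁ , q₂ , inj₁ q₁<0 , q₂<zx , q≤q₁+q₂) =
  *-mono {z} {y + z} {x} {x} (x≤y+x z y) (≤-refl {x}) q
    (downward (z * x) (p≤q+p q₁<0 q≤q₁+q₂) q₂<zx)
distribʳ-≥ x y z q (q₁ , q₂ , q₁<yx@(inj₂ _) , inj₁ q₂<0 , q≤q₁+q₂) =
  *-mono {y} {y + z} {x} {x} (x≤x+y y z) (≤-refl {x}) q
    (downward (y * x) (p≤q+p q₂<0 (ℚ.≤-trans q≤q₁+q₂ (ℚ.≤-reflexive (ℚ.+-comm q₁ q₂)))) q₁<yx)
distribʳ-≥ x y z q (q₁ , q₂ , inj₂ (a , b , 0≤a , 0≤b , a<y , b<x , q₁≤ab)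
                            , inj₂ (c , d , 0≤c , 0≤d , c<z , d<x , q₂≤cd) , q≤q₁+q₂) =
  -- The two products use different lower bounds for `x`; the larger one serves both.
  inj₂ (a ℚ.+ c , b ℚ.⊔ d , 0≤+ 0≤a 0≤c , ℚ.≤-trans 0≤b (ℚ.p≤p⊔q b d)
       , (a , c , a<y , c<z , ℚ.≤-refl) , b⊔d<x
       , ℚ.≤-trans q≤q₁+q₂ (ℚ.≤-trans
           (ℚ.+-mono-≤ (ℚ.≤-trans q₁≤ab (*-monoʳ-ℚ 0≤a (ℚ.p≤p⊔q b d)))
                       (ℚ.≤-trans q₂≤cd (*-monoʳ-ℚ 0≤c (ℚ.p≤q⊔p b d))))
           (ℚ.≤-reflexive (≡.sym (ℚ.*-distribʳ-+ (b ℚ.⊔ d) a c)))))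
  where
  b⊔d<x : Below x (b ℚ.⊔ d)
  b⊔d<x with ℚ.⊔-sel b d
  ... | inj₁ eq = ≡.subst (Below x) (≡.sym eq) b<x
  ... | inj₂ eq = ≡.subst (Below x) (≡.sym eq) d<x

-- The summable semiring [0,∞]

isCommutativeSemiring : IsCommutativeSemiring _≈_ _+_ _*_ 0# 1#
isCommutativeSemiring = isCommutativeSemiringˡ record
  { +-isCommutativeMonoid = record
    { isMonoid = record
      { isSemigroup = record
        { isMagma = record
          { isEquivalence = ≈-isEquivalence
          ; ∙-cong = λ {x} {y} {u} {v} (x≤y , y≤x) (u≤v , v≤u) →
              +-mono {x} {y} {u} {v} x≤y u≤v , +-mono {y} {x} {v} {u} y≤x v≤u
          }
        ; assoc = λ x y z → +-assoc-≤ x y z , +-assoc-≥ x y z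
        }
      ; identity = (λ x → +-identityˡ-≤ x , x≤y+x x 0#)
                 , (λ x → (λ q → +-identityˡ-≤ x q ∘ +-comm-≤ x 0# q) , x≤x+y x 0#)
      }
    ; comm = λ x y → +-comm-≤ x y , +-comm-≤ y x
    }
  ; *-isCommutativeMonoid = record
    { isMonoid = record
      { isSemigroup = record
        { isMagma = record
          { isEquivalence = ≈-isEquivalence
          ; ∙-cong = λ {x} {y} {u} {v} (x≤y , y≤x) (u≤v , v≤u) →
              *-mono {x} {y} {u} {v} x≤y u≤v , *-mono {y} {x} {v} {u} y≤x v≤u
          }
        ; assoc = λ x y z → *-assoc-≤ x y z , *-assoc-≥ x y z
        }
      ; identity = (λ x → *-identityˡ-≤ x , *-identityˡ-≥ x)
                 , (λ x → (λ q → *-identityˡ-≤ x q ∘ *-comm-≤ x 1# q)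
                        , (λ q → *-comm-≤ 1# x q ∘ *-identityˡ-≥ x q))
      }
    ; comm = λ x y → *-comm-≤ x y , *-comm-≤ y x
    }
  ; distribʳ = λ x y z → distribʳ-≤ x y z , distribʳ-≥ x y z
  ; zeroˡ    = λ x → *-zeroˡ-≤ x , 0≤ (0# * x)
  }

ℝ≥0∞-summableSemiring : SummableSemiring
ℝ≥0∞-summableSemiring = record
  { commutativeSemiring = record { isCommutativeSemiring = isCommutativeSemiring }
  ; _≤_                 = _≤_
  ; ≤-isPartialOrder    = ≤-isPartialOrder
  ; 0≤_                 = 0≤
  ; +-mono              = λ {x} {y} {u} {v} → +-mono {x} {y} {u} {v}
  ; *-mono              = λ {x} {y} {u} {v} → *-mono {x} {y} {u} {v}
  ; 𝟙                   = 𝟙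
  ; 𝟙-true              = λ p q q<1 → inj₂ (p , q<1)
  ; 𝟙-elim              = λ {P} {x} {y} → 𝟙-elim {P} {x} {y}
  ; ∑                   = ∑
  ; sumOver≤∑           = λ {A} {f} {xs} xs! q q<s → xs , xs! , q<s
  -- A rational below the whole is witnessed by a single finite list, so the assumed bound for that
  -- list suffices; the same holds for products.
  ; +-∑-least           = λ { h q (a , b , a<x , (xs , xs! , b<s) , q≤a+b) →
                              h xs xs! q (a , b , a<x , b<s , q≤a+b) }
  ; *-∑-least           = λ
    { {y = y} h q (inj₁ q<0) → negative y q<0
    ; h q (inj₂ (a , b , 0≤a , 0≤b , a<x , (xs , xs! , b<s) , q≤ab)) →
        h xs xs! q (inj₂ (a , b , 0≤a , 0≤b , a<x , b<s , q≤ab)) }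
  }

-- The Moser-Tardos execution as a weighted process

lemma2p6 : {n m : ℕ} (Ω : ProductDistribution n) (𝓑 : BadEvents n m)
    (μ : Fin m → ℝ≥0∞) → (∀ b → Finite (μ b)) →
    (∀ b → θ 𝓑 Ω μ (event 𝓑 b) ≤ μ b) →
    (σ : Rule 𝓑) (E : Event n) (b : Fin m) →
    MoserTardos.expectedCount Ω 𝓑 σ E b ≤ μ b * θ 𝓑 Ω μ E
lemma2p6 {n} {m} Ω 𝓑 μ _ θ≤μ σ E b =
  -- At this instance the abstract `count` and `θ` unfold to the quantities of the statement.
  ∑-count≤ moserTardos E b {μ b * θ 𝓑 Ω μ E} (𝔼-potential θ≤μ E b)
  where
  ω : Redraw.Marginals ℝ≥0∞-summableSemiring n
  ω i = mass (Ω i) , total (Ω i)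
  open Expectation ℝ≥0∞-summableSemiring ω 𝓑 using (Process; ∑-count≤; module Weights)
  open Weights μ using (𝔼-potential)
  open Summation ℝ≥0∞-summableSemiring using (∑-least; sumOver-mono; sumOver-zero)

  choice-total : ∀ {t} (r : Run n m t) → ∑ (choice σ r) ≤ 1#
  choice-total r with Fin.any? (λ c → T? (holds (event 𝓑 c) (current r)))
  ... | yes some = proj₁ (normalized σ r some)
  -- With no bad event true the execution has terminated: every choice vanishes, and so does each
  -- finite partial sum.
  ... | no none  = ∑-least {f = choice σ r} {y = 1#} λ xs _ q q<s →
    negative 1# (proj₁ (sumOver-zero xs) q
      (sumOver-mono {g = λ _ → 0#} (λ c → proj₁ (only-true σ r c λ true → none (c , true)))
        xs q q<s))

  moserTardos : Process
  moserTardos = record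
    { weight      = MoserTardos.runProb Ω 𝓑 σ
    ; choice      = choice σ
    ; initial     = λ x → ≤-refl {pmf Ω x}
    ; step        = λ r c y → ≤-refl {MoserTardos.runProb Ω 𝓑 σ (extend r c y)}
    ; choose-true = λ r c ¬true → proj₁ (only-true σ r c ¬true)
    ; choose-one  = choice-total
    }
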